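{- Let $C_m=\frac{1}{m+1}\binom{2m}{m}$ denote the $m$-th Catalan number. Label the vertices of a regular convex $N$-gon by $0,1,\ldots,N-1$ in cyclic order. For vertices $x\neq y$, let $f_{xy}(N)$ denote the number of triangulations of this $N$-gon that contain no diagonal parallel to the segment $xy$. Then: (i) for every $n\ge 2$, $f_{01}(2n)=2C_{2n-3}$; (ii) for every $n\ge 2$, $f_{02}(2n)=C_{2n-1}+2C_{2n-2}-2^{2n-1}C_{n-1}$; (iii) for every $n\ge 1$, $f_{01}(2n+1)=2^{2n-1}C_{n-1}-C_{2n-1}$.
   Context: A triangulation of a convex $N$-gon is a maximal set of pairwise non-crossing diagonals (there are $N-3$ of them), viewed as a graph on the vertices $0,\ldots,N-1$ whose edges are the $N$ sides $01,12,\ldots,(N-1)0$ together with these diagonals; there are $C_{N-2}$ triangulations. Here $xy$ may be a side (e.g. $01$) or a diagonal (e.g. $02$) of the regular polygon, and "parallel" means parallel as line segments in the regular $N$-gon (equivalently, $ab$ is parallel to $cd$ iff $a+b\equiv c+d \pmod N$). -}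

module Defs where

open import Data.List using (List; []; _∷_; _++_; map; filter; length; upTo; cartesianProduct)
open import Data.List.Membership.Propositional using (_∈_; find)
open import Data.List.Membership.Propositional.Properties using (∈-filter⁺; ∈-upTo⁺; ∈-cartesianProduct⁺)
open import Data.List.Relation.Binary.Subset.Propositional using (_⊆_)
open import Data.List.Relation.Unary.All as All using (All; []; _∷_)
open import Data.List.Relation.Unary.All.Properties using (all-filter)
open import Data.List.Relation.Unary.Any as Any using (Any; here; there)
open import Data.Nat using (ℕ; suc; _+_; _*_; _<_; _/_; _<?_; _≟_; ∣_-_∣)
open import Data.Nat.Combinatorics using (_C_)
open import Data.Nat.Divisibility using (_∣_; _∣?_)
open import Data.Nat.Properties using (<-irrefl; <-trans)
open import Data.Product using (_×_; _,_; proj₁)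
open import Data.Product.Properties using (≡-dec)
open import Data.Sum using (_⊎_; inj₁; inj₂; swap)
open import Relation.Binary.Definitions using (DecidableEquality)
open import Relation.Binary.PropositionalEquality using (_≡_; refl)
open import Relation.Nullary using (¬_; Dec; yes; no; contradiction)
open import Relation.Nullary.Decidable using (¬?; map′; _×-dec_; _⊎-dec_)

-- The division is exact.
catalan : ℕ → ℕ
catalan m = ((2 * m) C m) / suc m

_≡_[mod_] : ℕ → ℕ → ℕ → Set
a ≡ b [mod N ] = N ∣ ∣ a - b ∣

-- A segment is given by the labels of its two endpoints.
Segment : Set
Segment = ℕ × ℕ

_≟ˢ_ : DecidableEquality Segment
_≟ˢ_ = ≡-dec _≟_ _≟_

IsSide : ℕ → Segment → Set
IsSide N (a , b) = suc a ≡ b [mod N ] ⊎ suc b ≡ a [mod N ]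

-- Every (unoriented) diagonal of the N-gon with vertices 0, …, N-1 is
-- represented exactly once, smaller endpoint first.
IsDiagonal : ℕ → Segment → Set
IsDiagonal N (a , b) = a < b × b < N × ¬ IsSide N (a , b)

isDiagonal? : ∀ N d → Dec (IsDiagonal N d)
isDiagonal? N (a , b) =
  a <? b ×-dec b <? N ×-dec
  ¬? (N ∣? ∣ suc a - b ∣ ⊎-dec N ∣? ∣ suc b - a ∣)

-- For segments listed smaller endpoint first: their interiors meet in a
-- single point iff the endpoints strictly interleave.
Crossing : Segment → Segment → Set
Crossing (a , b) (c , d) = (a < c × c < b × b < d) ⊎ (c < a × a < d × d < b)

crossing? : ∀ d e → Dec (Crossing d e)
crossing? (a , b) (c , d) =
  (a <? c ×-dec c <? b ×-dec b <? d) ⊎-dec (c <? a ×-dec a <? d ×-dec d <? b)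

-- ab ∥ cd in the regular N-gon iff a + b ≡ c + d (mod N); in particular
-- every segment is parallel to itself.
Parallel : ℕ → Segment → Segment → Set
Parallel N (a , b) (c , d) = (a + b) ≡ (c + d) [mod N ]

parallel? : ∀ N d e → Dec (Parallel N d e)
parallel? N (a , b) (c , d) = N ∣? ∣ (a + b) - (c + d) ∣

IsNonCrossing : ℕ → List Segment → Set
IsNonCrossing N S =
  All (IsDiagonal N) S × All (λ d → All (λ e → ¬ Crossing d e) S) S

-- Lists stand for their sets of elements here: _⊆_ is inclusion of these sets.
IsTriangulation : ℕ → List Segment → Set
IsTriangulation N S =
  IsNonCrossing N S × (∀ T → IsNonCrossing N T → S ⊆ T → T ⊆ S)

diagonals : ℕ → List Segment
diagonals N = filter (isDiagonal? N) (cartesianProduct (upTo N) (upTo N))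

∈-diagonals : ∀ N {d} → IsDiagonal N d → d ∈ diagonals N
∈-diagonals N p@(a<b , b<N , _) =
  ∈-filter⁺ (isDiagonal? N)
    (∈-cartesianProduct⁺ (∈-upTo⁺ (<-trans a<b b<N)) (∈-upTo⁺ b<N)) p

crossing-irrefl : ∀ d → ¬ Crossing d d
crossing-irrefl _ (inj₁ (a<a , _)) = <-irrefl refl a<a
crossing-irrefl _ (inj₂ (a<a , _)) = <-irrefl refl a<a

-- Maximality is decided by trying to add one diagonal at a time.
isTriangulation? : ∀ N S → Dec (IsTriangulation N S)
isTriangulation? N S with All.all? (isDiagonal? N) S
                        ×-dec All.all? (λ d → All.all? (λ e → ¬? (crossing? d e)) S) S
... | no ¬nc = no λ t → ¬nc (proj₁ t)
... | yes nc@(diag , ncr) = map′ to from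
        (All.all? (λ d → Any.any? (d ≟ˢ_) S ⊎-dec Any.any? (crossing? d) S) (diagonals N))
  where
  Blocked : Segment → Set
  Blocked d = d ∈ S ⊎ Any (Crossing d) S

  to : All Blocked (diagonals N) → IsTriangulation N S
  to blocked = nc , maximal
    where
    maximal : ∀ T → IsNonCrossing N T → S ⊆ T → T ⊆ S
    maximal T (diagT , ncrT) S⊆T d∈T
      with All.lookup blocked (∈-diagonals N (All.lookup diagT d∈T))
    ... | inj₁ d∈S = d∈S
    ... | inj₂ any with find any
    ...   | _ , e∈S , cr = contradiction cr (All.lookup (All.lookup ncrT d∈T) (S⊆T e∈S))

  from : IsTriangulation N S → All Blocked (diagonals N)
  from (_ , maximal) = All.tabulate λ {d} d∈ → block d (All.lookup all-diagonal d∈)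
    where
    all-diagonal : All (IsDiagonal N) (diagonals N)
    all-diagonal = all-filter (isDiagonal? N) (cartesianProduct (upTo N) (upTo N))

    block : ∀ d → IsDiagonal N d → Blocked d
    block d isd with Any.any? (crossing? d) S
    ... | yes any = inj₂ any
    ... | no ¬any = inj₁ (maximal (d ∷ S) (isd ∷ diag , ncr′) there (here refl))
      where
      ncr′ : All (λ x → All (λ e → ¬ Crossing x e) (d ∷ S)) (d ∷ S)
      ncr′ = (crossing-irrefl d ∷ All.tabulate λ e∈S cr → ¬any (Any.map (λ { refl → cr }) e∈S))
           ∷ All.tabulate λ e∈S →
               (λ cr → ¬any (Any.map (λ { refl → swap cr }) e∈S)) ∷ All.lookup ncr e∈S

-- Applied to a list without repetitions such as diagonals N, this lists every
-- subset of its elements exactly once (as a list in the original order).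
subsets : ∀ {A : Set} → List A → List (List A)
subsets []       = [] ∷ []
subsets (x ∷ xs) = map (x ∷_) (subsets xs) ++ subsets xs

NoParallel : ℕ → Segment → List Segment → Set
NoParallel N s S = All (λ d → ¬ Parallel N d s) S

noParallel? : ∀ N s S → Dec (NoParallel N s S)
noParallel? N s = All.all? (λ d → ¬? (parallel? N d s))

-- f x y N counts the triangulations of the N-gon without a diagonal parallel
-- to xy. It is meaningful for 3 ≤ N and distinct x, y < N.
f : ℕ → ℕ → ℕ → ℕ
f x y N =
  length (filter (λ S → isTriangulation? N S ×-dec noParallel? N (x , y) S)
                 (subsets (diagonals N)))

{-# OPTIONS --safe #-}

-- Call the diagonals parallel to xy rungs. Up to the exceptional edge 02 they are the edges whose
-- endpoints add up to a constant s, so they are nested, and a triangulation with a rung is cut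
-- uniquely along its innermost rung. Let C_d be the Catalan number counting all triangulations
-- over an edge (i , i+d+1), and let A i d and Z p e count those without rungs, where in Z the base
-- edge itself is a rung. Then
--   C_d = A i d + Σ_{u+v+e=d} Z (i+u) e · C_{u+v},
-- which determines Z on rungs, and then A. In terms of E = Σ C_{2k} X^k and O = Σ C_{2k+1} X^k the
-- solution rests on E = 1 + 2XOE and O = E² + XO², which are Segner's recurrence split by parity,
-- and on their consequence E² = Σ 4^k C_k X^k (Shapiro's convolution).
module Submission where

-- If the base is itself a rung, then `A` vanishes there and every nested rung leaves equally many
-- vertices on its two sides. The cutting identity thus becomes a convolution with `E`: split by the
-- parity of the size, the fillings satisfy E - 1 = E Z for even sizes and O = E Z for odd sizes.
-- Hence Z = 2XO in the first case and Z = O / E = 2E² - O in the second. Since `ℕ` allows neither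
-- division nor subtraction, these values enter as pairs `b`, `c` with Z + c = b, verified by strong
-- induction on the size. Rung sizes have the parity of s - 1. The side 01 gives s = N + 1, so the
-- parity of N selects one of the two solutions; the diagonal 02 gives s = N + 2, and for even N the
-- sizes are odd. Besides s, the sum 2 is then possible, but only for the edge 02 itself, which is
-- not nested with the others; the triangulations containing it are subtracted separately.

open import Defs
open import Algebra.Bundles using (CommutativeSemiring)
import Algebra.Solver.Ring.NaturalCoefficients.Default as SemiringSolver
open import Data.Bool using (if_then_else_)
open import Data.List using (List; []; _∷_; _++_; map; filter; length; cartesianProductWith)
open import Data.List.Properties using (length-++; ∷-injectiveʳ; length-map)
open import Data.List.Membership.Propositional using (_∈_; find; lose)
open import Data.List.Membership.Propositional.Properties
open import Data.List.Membership.DecPropositional _≟ˢ_ using (_∈?_)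
open import Data.List.Relation.Binary.Subset.Propositional using (_⊆_)
open import Data.List.Relation.Unary.All as All using (All; []; _∷_)
import Data.List.Relation.Unary.All.Properties as All
open import Data.List.Relation.Unary.AllPairs using ([]; _∷_)
open import Data.List.Relation.Unary.Any as Any using (here; there)
open import Data.List.Relation.Unary.Unique.Propositional using (Unique)
import Data.List.Relation.Unary.Unique.Propositional.Properties as Unique
open import Data.Nat
open import Data.Nat.Combinatorics using (_C_; nC1≡n; k>n⇒nCk≡0; nCk≡nC[n∸k]; nCk+nC[k+1]≡[n+1]C[k+1])
open import Data.Nat.Divisibility using (_∣_; divides; ∣⇒≤; ∣-refl; _∣0)
open import Data.Nat.DivMod using (m*n/n≡m)
open import Data.Nat.Induction using (<-rec)
open import Data.Nat.Properties
open import Data.Nat.Tactic.RingSolver using (solve-∀)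
open import Data.Product using (_×_; _,_; proj₁; proj₂; ∃; ∃-syntax)
open import Data.Sum using (_⊎_; inj₁; inj₂; swap; [_,_]′)
open import Function using (_⇔_; mk⇔; Equivalence; flip)
open import Level using (0ℓ)
open import Relation.Binary.Definitions using (tri<; tri≈; tri>)
import Relation.Binary.Reasoning.Setoid as SetoidReasoning
open import Relation.Binary.PropositionalEquality
open import Relation.Nullary
open import Relation.Nullary.Decidable using (¬?; _×-dec_; does-⇔)
open import Relation.Unary using (Pred; Decidable)

open ≡-Reasoning

-- Sums over a + b = n

∑ : (ℕ → ℕ → ℕ) → ℕ → ℕ
∑ h zero    = h 0 0
∑ h (suc n) = h 0 (suc n) + ∑ (λ a b → h (suc a) b) n

∑-cong : ∀ {h k} n → (∀ a b → a + b ≡ n → h a b ≡ k a b) → ∑ h n ≡ ∑ k n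
∑-cong zero    eq = eq 0 0 refl
∑-cong (suc n) eq = cong₂ _+_ (eq 0 (suc n) refl) (∑-cong n λ a b p → eq (suc a) b (cong suc p))

∑-zero : ∀ {h} n → (∀ a b → a + b ≡ n → h a b ≡ 0) → ∑ h n ≡ 0
∑-zero zero    eq = eq 0 0 refl
∑-zero (suc n) eq = cong₂ _+_ (eq 0 (suc n) refl) (∑-zero n λ a b p → eq (suc a) b (cong suc p))

∑-+ : ∀ h k n → ∑ (λ a b → h a b + k a b) n ≡ ∑ h n + ∑ k n
∑-+ h k zero    = refl
∑-+ h k (suc n) =
  trans (cong (h 0 (suc n) + k 0 (suc n) +_) (∑-+ (λ a → h (suc a)) (λ a → k (suc a)) n))
        (+-interchange (h 0 (suc n)) (k 0 (suc n)) _ _)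
  where
  +-interchange : ∀ a b c d → a + b + (c + d) ≡ a + c + (b + d)
  +-interchange = solve-∀

∑-*ˡ : ∀ c h n → ∑ (λ a b → c * h a b) n ≡ c * ∑ h n
∑-*ˡ c h zero    = refl
∑-*ˡ c h (suc n) =
  trans (cong (c * h 0 (suc n) +_) (∑-*ˡ c (λ a → h (suc a)) n))
        (sym (*-distribˡ-+ c (h 0 (suc n)) _))

∑-*ʳ : ∀ c h n → ∑ (λ a b → h a b * c) n ≡ ∑ h n * c
∑-*ʳ c h n = begin
  ∑ (λ a b → h a b * c) n ≡⟨ ∑-cong n (λ a b _ → *-comm (h a b) c) ⟩
  ∑ (λ a b → c * h a b) n ≡⟨ ∑-*ˡ c h n ⟩
  c * ∑ h n               ≡⟨ *-comm c _ ⟩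
  ∑ h n * c               ∎

∑-last : ∀ h n → ∑ h (suc n) ≡ ∑ (λ a b → h a (suc b)) n + h (suc n) 0
∑-last h zero    = refl
∑-last h (suc n) =
  trans (cong (h 0 (2 + n) +_) (∑-last (λ a → h (suc a)) n)) (sym (+-assoc (h 0 (2 + n)) _ _))

∑-swap : ∀ h n → ∑ h n ≡ ∑ (flip h) n
∑-swap h zero    = refl
∑-swap h (suc n) = begin
  h 0 (suc n) + ∑ (λ a b → h (suc a) b) n ≡⟨ +-comm (h 0 (suc n)) _ ⟩
  ∑ (λ a b → h (suc a) b) n + h 0 (suc n)
    ≡⟨ cong (_+ h 0 (suc n)) (∑-swap (λ a b → h (suc a) b) n) ⟩
  ∑ (λ a b → h (suc b) a) n + h 0 (suc n) ≡⟨ ∑-last (flip h) n ⟨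
  ∑ (flip h) (suc n)                      ∎

∑-assoc : ∀ (h : ℕ → ℕ → ℕ → ℕ) n →
  ∑ (λ a q → ∑ (h a) q) n ≡ ∑ (λ q c → ∑ (λ a b → h a b c) q) n
∑-assoc h zero    = refl
∑-assoc h (suc n) = begin
  h 0 0 (suc n) + ∑ (λ b c → h 0 (suc b) c) n + ∑ (λ a q → ∑ (h (suc a)) q) n
    ≡⟨ cong (h 0 0 (suc n) + ∑ (λ b c → h 0 (suc b) c) n +_) (∑-assoc (λ a → h (suc a)) n) ⟩
  h 0 0 (suc n) + ∑ (λ b c → h 0 (suc b) c) n + ∑ (λ q c → ∑ (λ a b → h (suc a) b c) q) n
    ≡⟨ +-assoc (h 0 0 (suc n)) _ _ ⟩
  h 0 0 (suc n) + (∑ (λ b c → h 0 (suc b) c) n + ∑ (λ q c → ∑ (λ a b → h (suc a) b c) q) n)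
    ≡⟨ cong (h 0 0 (suc n) +_) (∑-+ (λ q → h 0 (suc q)) (λ q c → ∑ (λ a b → h (suc a) b c) q) n) ⟨
  ∑ (λ q c → ∑ (λ a b → h a b c) q) (suc n) ∎

∑-exchange : ∀ (h : ℕ → ℕ → ℕ → ℕ → ℕ) m n →
  ∑ (λ a b → ∑ (h a b) n) m ≡ ∑ (λ c d → ∑ (λ a b → h a b c d) m) n
∑-exchange h zero    n = refl
∑-exchange h (suc m) n =
  trans (cong (∑ (h 0 (suc m)) n +_) (∑-exchange (λ a → h (suc a)) m n))
        (sym (∑-+ (h 0 (suc m)) _ n))

double : ℕ → ℕ
double zero    = zero
double (suc n) = suc (suc (double n))

double≡2* : ∀ n → double n ≡ 2 * n
double≡2* zero    = refl
double≡2* (suc n) = trans (cong (λ k → suc (suc k)) (double≡2* n)) (lem n)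
  where
  lem : ∀ n → suc (suc (2 * n)) ≡ 2 * suc n
  lem = solve-∀

∑-odd : ∀ h n → ∑ h (suc (double n)) ≡
  ∑ (λ c d → h (double c) (suc (double d))) n + ∑ (λ c d → h (suc (double c)) (double d)) n
∑-odd h zero    = refl
∑-odd h (suc n) =
  trans (cong (λ t → h 0 (3 + double n) + (h 1 (2 + double n) + t)) (∑-odd (λ a → h (2 + a)) n))
        (lem (h 0 (3 + double n)) (h 1 (2 + double n)) _ _)
  where
  lem : ∀ a b c d → a + (b + (c + d)) ≡ a + c + (b + d)
  lem = solve-∀

∑-even : ∀ h n → ∑ h (double (suc n)) ≡
  ∑ (λ c d → h (double c) (double d)) (suc n) + ∑ (λ c d → h (suc (double c)) (suc (double d))) n
∑-even h zero    = lem (h 0 2) (h 1 1) (h 2 0)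
  where
  lem : ∀ a b c → a + (b + c) ≡ a + c + b
  lem = solve-∀
∑-even h (suc n) =
  trans (cong (λ t → h 0 (4 + double n) + (h 1 (3 + double n) + t)) (∑-even (λ a → h (2 + a)) n))
        (lem (h 0 (4 + double n)) (h 1 (3 + double n)) _ _)
  where
  lem : ∀ a b c d → a + (b + (c + d)) ≡ a + c + (b + d)
  lem = solve-∀

-- Catalan numbers

absorption : ∀ n k → suc k * (suc n C suc k) ≡ suc n * (n C k)
absorption n zero = begin
  1 * (suc n C 1) ≡⟨ *-identityˡ _ ⟩
  suc n C 1       ≡⟨ nC1≡n (suc n) ⟩
  suc n           ≡⟨ *-identityʳ (suc n) ⟨
  suc n * 1       ≡⟨⟩
  suc n * (n C 0) ∎
absorption zero (suc k) = trans (cong (suc (suc k) *_) (k>n⇒nCk≡0 {1} {2 + k} (s≤s (s≤s z≤n))))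
  (trans (*-zeroʳ (suc (suc k))) (sym (trans (*-identityˡ _) (k>n⇒nCk≡0 {0} {1 + k} (s≤s z≤n)))))
absorption (suc n) (suc k) = begin
  (2 + k) * (suc (suc n) C suc (suc k))
    ≡⟨ cong ((2 + k) *_) (nCk+nC[k+1]≡[n+1]C[k+1] (suc n) (suc k)) ⟨
  (2 + k) * ((suc n C suc k) + (suc n C suc (suc k)))
    ≡⟨ lem₁ (suc k) (suc n C suc k) (suc n C suc (suc k)) ⟩
  (suc n C suc k) + (suc k * (suc n C suc k) + suc (suc k) * (suc n C suc (suc k)))
    ≡⟨ cong₂ (λ x y → (suc n C suc k) + (x + y)) (absorption n k) (absorption n (suc k)) ⟩
  (suc n C suc k) + (suc n * (n C k) + suc n * (n C suc k))
    ≡⟨ cong ((suc n C suc k) +_) (*-distribˡ-+ (suc n) (n C k) (n C suc k)) ⟨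
  (suc n C suc k) + suc n * ((n C k) + (n C suc k))
    ≡⟨ cong (λ x → (suc n C suc k) + suc n * x) (nCk+nC[k+1]≡[n+1]C[k+1] n k) ⟩
  (2 + n) * (suc n C suc k) ∎
  where
  lem₁ : ∀ k x y → suc k * (x + y) ≡ x + (k * x + suc k * y)
  lem₁ = solve-∀

centralBinomial-step : ∀ m →
  suc m * ((2 * suc m) C suc m) ≡ 2 * (suc (2 * m) * ((2 * m) C m))
centralBinomial-step m = begin
  suc m * ((2 * suc m) C suc m)
    ≡⟨ cong (λ k → suc m * (k C suc m)) (lem₁ m) ⟩
  suc m * (suc (suc (2 * m)) C suc m)
    ≡⟨ absorption (suc (2 * m)) m ⟩
  suc (suc (2 * m)) * (suc (2 * m) C m)
    ≡⟨ cong (suc (suc (2 * m)) *_) sym-C ⟩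
  suc (suc (2 * m)) * (suc (2 * m) C suc m)
    ≡⟨ lem₂ m (suc (2 * m) C suc m) ⟩
  2 * (suc m * (suc (2 * m) C suc m))
    ≡⟨ cong (2 *_) (absorption (2 * m) m) ⟩
  2 * (suc (2 * m) * ((2 * m) C m)) ∎
  where
  lem₁ : ∀ m → 2 * suc m ≡ suc (suc (2 * m))
  lem₁ = solve-∀
  lem₂ : ∀ m x → suc (suc (2 * m)) * x ≡ 2 * (suc m * x)
  lem₂ = solve-∀
  lem₃ : ∀ m → suc (2 * m) ≡ m + suc m
  lem₃ = solve-∀
  sym-C : suc (2 * m) C m ≡ suc (2 * m) C suc m
  sym-C = begin
    suc (2 * m) C m
      ≡⟨ nCk≡nC[n∸k] (≤-trans (m≤m+n m (suc m)) (≤-reflexive (sym (lem₃ m)))) ⟩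
    suc (2 * m) C (suc (2 * m) ∸ m)
      ≡⟨ cong (suc (2 * m) C_) (trans (cong (_∸ m) (lem₃ m)) (m+n∸m≡n m (suc m))) ⟩
    suc (2 * m) C suc m ∎

1+m*catalan : ∀ m → suc m * catalan m ≡ (2 * m) C m
1+m*catalan m = begin
  suc m * (((2 * m) C m) / suc m)       ≡⟨ cong (λ k → suc m * (k / suc m)) exact ⟩
  suc m * (q * suc m / suc m)           ≡⟨ cong (suc m *_) (m*n/n≡m q (suc m)) ⟩
  suc m * q                             ≡⟨ *-comm (suc m) q ⟩
  q * suc m                             ≡⟨ exact ⟨
  (2 * m) C m                           ∎
  where
  -- The classical difference formula for Catalan numbers supplies the quotient, so the division in
  -- `catalan` is seen to be exact.
  q = ((2 * m) C m) ∸ ((2 * m) C suc m)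
  lem : ∀ m x → suc (2 * m) * x ≡ suc m * x + m * x
  lem = solve-∀
  above : suc m * ((2 * m) C suc m) ≡ m * ((2 * m) C m)
  above = +-cancelˡ-≡ (suc m * ((2 * m) C m)) _ _ (begin
    suc m * ((2 * m) C m) + suc m * ((2 * m) C suc m)
      ≡⟨ *-distribˡ-+ (suc m) ((2 * m) C m) _ ⟨
    suc m * (((2 * m) C m) + ((2 * m) C suc m))
      ≡⟨ cong (suc m *_) (nCk+nC[k+1]≡[n+1]C[k+1] (2 * m) m) ⟩
    suc m * (suc (2 * m) C suc m)
      ≡⟨ absorption (2 * m) m ⟩
    suc (2 * m) * ((2 * m) C m)
      ≡⟨ lem m ((2 * m) C m) ⟩
    suc m * ((2 * m) C m) + m * ((2 * m) C m) ∎)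
  exact : (2 * m) C m ≡ q * suc m
  exact = begin
    (2 * m) C m
      ≡⟨ m+n∸n≡m ((2 * m) C m) (m * ((2 * m) C m)) ⟨
    suc m * ((2 * m) C m) ∸ m * ((2 * m) C m)
      ≡⟨ cong (suc m * ((2 * m) C m) ∸_) above ⟨
    suc m * ((2 * m) C m) ∸ suc m * ((2 * m) C suc m)
      ≡⟨ *-distribˡ-∸ (suc m) ((2 * m) C m) ((2 * m) C suc m) ⟨
    suc m * q
      ≡⟨ *-comm (suc m) q ⟩
    q * suc m ∎

catalan-step : ∀ m → suc (suc m) * catalan (suc m) ≡ 2 * suc (2 * m) * catalan m
catalan-step m = *-cancelˡ-≡ _ _ (suc m) (begin
  suc m * (suc (suc m) * catalan (suc m))  ≡⟨ cong (suc m *_) (1+m*catalan (suc m)) ⟩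
  suc m * ((2 * suc m) C suc m)            ≡⟨ centralBinomial-step m ⟩
  2 * (suc (2 * m) * ((2 * m) C m))        ≡⟨ cong (λ x → 2 * (suc (2 * m) * x)) (1+m*catalan m) ⟨
  2 * (suc (2 * m) * (suc m * catalan m))  ≡⟨ lem m (catalan m) ⟩
  suc m * (2 * suc (2 * m) * catalan m)    ∎)
  where
  lem : ∀ m x → 2 * (suc (2 * m) * (suc m * x)) ≡ suc m * (2 * suc (2 * m) * x)
  lem = solve-∀

-- Adding the sum to its mirror image replaces the weight `a` by its mean n / 2; the factor 2 avoids
-- the fraction.
∑-symmetric : ∀ h n → (∀ a b → h a b ≡ h b a) →
  ∀ p q → 2 * ∑ (λ a b → (p + q * a) * h a b) n ≡ (2 * p + q * n) * ∑ h n
∑-symmetric h n h-sym p q = begin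
  2 * S                        ≡⟨ cong (S +_) (+-identityʳ S) ⟩
  S + S                        ≡⟨ cong (S +_) (∑-swap _ n) ⟩
  S + ∑ (λ a b → (p + q * b) * h b a) n
                               ≡⟨ ∑-+ _ _ n ⟨
  ∑ (λ a b → (p + q * a) * h a b + (p + q * b) * h b a) n
                               ≡⟨ ∑-cong n (λ { a b refl → trans (cong (λ x → (p + q * a) * h a b + (p + q * b) * x) (h-sym b a))
                                                            (lem p q a b (h a b)) }) ⟩
  ∑ (λ a b → (2 * p + q * n) * h a b) n ≡⟨ ∑-*ˡ (2 * p + q * n) h n ⟩
  (2 * p + q * n) * ∑ h n      ∎
  where
  S = ∑ (λ a b → (p + q * a) * h a b) n
  lem : ∀ p q a b x → (p + q * a) * x + (p + q * b) * x ≡ (2 * p + q * (a + b)) * x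
  lem = solve-∀

-- Segner's recurrence, by evaluating the sum of (1 + a) C_a C_b over a + b = n + 1 in two ways.
-- Symmetry gives (n + 3) / 2 times the wanted sum. Lowering the index with `catalan-step` gives a
-- sum over a + b = n, to which symmetry and the induction hypothesis apply.
catalan-suc : ∀ n → catalan (suc n) ≡ ∑ (λ a b → catalan a * catalan b) n
catalan-suc zero    = refl
catalan-suc (suc n) = *-cancelˡ-≡ _ _ (3 + n) (begin
  (3 + n) * c (2 + n)
    ≡⟨ catalan-step (suc n) ⟩
  2 * suc (2 * suc n) * c (suc n)
    ≡⟨ lem₁ n (c (suc n)) ⟩
  2 * c (suc n) + (2 * 2 + 4 * n) * c (suc n)
    ≡⟨ cong (λ x → 2 * c (suc n) + (2 * 2 + 4 * n) * x) (catalan-suc n) ⟩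
  2 * c (suc n) + (2 * 2 + 4 * n) * ∑ cc n
    ≡⟨ cong (2 * c (suc n) +_) (∑-symmetric cc n (λ a b → *-comm (c a) (c b)) 2 4) ⟨
  2 * c (suc n) + 2 * ∑ (λ a b → (2 + 4 * a) * cc a b) n
    ≡⟨ *-distribˡ-+ 2 (c (suc n)) _ ⟨
  2 * (c (suc n) + ∑ (λ a b → (2 + 4 * a) * cc a b) n)
    ≡⟨ cong (2 *_) (cong₂ _+_ (lem₃ (c (suc n))) (∑-cong n λ a b _ → lower a b)) ⟩
  2 * ∑ (λ a b → (1 + 1 * a) * cc a b) (suc n)
    ≡⟨ ∑-symmetric cc (suc n) (λ a b → *-comm (c a) (c b)) 1 1 ⟩
  (2 * 1 + 1 * suc n) * ∑ cc (suc n)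
    ≡⟨ cong (_* ∑ cc (suc n)) (lem₂ n) ⟩
  (3 + n) * ∑ cc (suc n) ∎)
  where
  c = catalan
  cc : ℕ → ℕ → ℕ
  cc a b = catalan a * catalan b
  lem₁ : ∀ n x → 2 * suc (2 * suc n) * x ≡ 2 * x + (2 * 2 + 4 * n) * x
  lem₁ = solve-∀
  lem₂ : ∀ n → 2 * 1 + 1 * suc n ≡ 3 + n
  lem₂ = solve-∀
  lem₃ : ∀ x → x ≡ 1 * (1 * x)
  lem₃ = solve-∀
  lem₄ : ∀ a → 1 + 1 * suc a ≡ 2 + a
  lem₄ = solve-∀
  lem₅ : ∀ a → 2 + 4 * a ≡ 2 * suc (2 * a)
  lem₅ = solve-∀
  lower : ∀ a b → (2 + 4 * a) * cc a b ≡ (1 + 1 * suc a) * cc (suc a) b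
  lower a b = begin
    (2 + 4 * a) * (c a * c b)          ≡⟨ *-assoc (2 + 4 * a) (c a) (c b) ⟨
    (2 + 4 * a) * c a * c b            ≡⟨ cong (λ x → x * c a * c b) (lem₅ a) ⟩
    2 * suc (2 * a) * c a * c b        ≡⟨ cong (_* c b) (catalan-step a) ⟨
    (2 + a) * c (suc a) * c b          ≡⟨ cong (λ x → x * c (suc a) * c b) (lem₄ a) ⟨
    (1 + 1 * suc a) * c (suc a) * c b  ≡⟨ *-assoc (1 + 1 * suc a) (c (suc a)) (c b) ⟩
    (1 + 1 * suc a) * cc (suc a) b     ∎

-- Generating functions of the Catalan numbers of even and of odd index

Series : Set
Series = ℕ → ℕ

infixl 6 _⊕_
infixl 7 _⊛_

_⊕_ _⊛_ : Series → Series → Series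
(f ⊕ g) n = f n + g n
(f ⊛ g) n = ∑ (λ a b → f a * g b) n

𝟘 𝟙 X : Series
𝟘 _       = 0
𝟙 zero    = 1
𝟙 (suc _) = 0
X zero    = 0
X (suc n) = 𝟙 n

⊛-cong : ∀ {f f′ g g′} → f ≗ f′ → g ≗ g′ → f ⊛ g ≗ f′ ⊛ g′
⊛-cong p q n = ∑-cong n λ a b _ → cong₂ _*_ (p a) (q b)

⊛-assoc : ∀ f g h → (f ⊛ g) ⊛ h ≗ f ⊛ (g ⊛ h)
⊛-assoc f g h n = begin
  ∑ (λ q c → ∑ (λ a b → f a * g b) q * h c) n
    ≡⟨ ∑-cong n (λ q c _ → trans (sym (∑-*ʳ (h c) (λ a b → f a * g b) q))
                                 (∑-cong q λ a b _ → *-assoc (f a) (g b) (h c))) ⟩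
  ∑ (λ q c → ∑ (λ a b → f a * (g b * h c)) q) n
    ≡⟨ ∑-assoc (λ a b c → f a * (g b * h c)) n ⟨
  ∑ (λ a q → ∑ (λ b c → f a * (g b * h c)) q) n
    ≡⟨ ∑-cong n (λ a q _ → ∑-*ˡ (f a) (λ b c → g b * h c) q) ⟩
  ∑ (λ a q → f a * ∑ (λ b c → g b * h c) q) n ∎

⊛-comm : ∀ f g → f ⊛ g ≗ g ⊛ f
⊛-comm f g n = trans (∑-swap (λ a b → f a * g b) n) (∑-cong n λ a b _ → *-comm (f b) (g a))

⊛-identityˡ : ∀ f → 𝟙 ⊛ f ≗ f
⊛-identityˡ f zero    = +-identityʳ (f 0)
⊛-identityˡ f (suc n) = trans (cong₂ _+_ (+-identityʳ (f (suc n))) (∑-zero n λ _ _ _ → refl))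
                              (+-identityʳ (f (suc n)))

⊛-distribˡ : ∀ f g h → f ⊛ (g ⊕ h) ≗ f ⊛ g ⊕ f ⊛ h
⊛-distribˡ f g h n = trans (∑-cong n λ a b _ → *-distribˡ-+ (f a) (g b) (h b)) (∑-+ _ _ n)

X⊛-suc : ∀ f n → (X ⊛ f) (suc n) ≡ f n
X⊛-suc f n = ⊛-identityˡ f n

-- Coefficients in `ℕ` give a semiring without negation. Identities that would subtract are
-- therefore proved by adding a common series to both sides and removing it with `⊕-cancelʳ`.
series : CommutativeSemiring 0ℓ 0ℓ
series = record
  { Carrier = Series ; _≈_ = _≗_ ; _+_ = _⊕_ ; _*_ = _⊛_ ; 0# = 𝟘 ; 1# = 𝟙
  ; isCommutativeSemiring = record
    { isSemiring = record
      { isSemiringWithoutAnnihilatingZero = record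
        { +-isCommutativeMonoid = record
          { isMonoid = record
            { isSemigroup = record
              { isMagma = record
                { isEquivalence = record
                  { refl = λ _ → refl
                  ; sym = λ p n → sym (p n)
                  ; trans = λ p q n → trans (p n) (q n) }
                ; ∙-cong = λ p q n → cong₂ _+_ (p n) (q n) }
              ; assoc = λ f g h n → +-assoc (f n) (g n) (h n) }
            ; identity = (λ _ _ → refl) , λ f n → +-identityʳ (f n) }
          ; comm = λ f g n → +-comm (f n) (g n) }
        ; *-cong = ⊛-cong
        ; *-assoc = ⊛-assoc
        ; *-identity = ⊛-identityˡ , λ f n → trans (⊛-comm f 𝟙 n) (⊛-identityˡ f n)
        ; distrib = ⊛-distribˡ , λ f g h n →
            trans (⊛-comm (g ⊕ h) f n)
              (trans (⊛-distribˡ f g h n) (cong₂ _+_ (⊛-comm f g n) (⊛-comm f h n))) }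
      ; zero = (λ _ n → ∑-zero n λ _ _ _ → refl)
             , λ f n → ∑-zero n λ a _ _ → *-zeroʳ (f a) }
    ; *-comm = ⊛-comm } }

open CommutativeSemiring series using () renaming (refl to ≗-refl)
open SemiringSolver series using (solve; _:=_; _:+_; _:*_; con)

open SetoidReasoning (CommutativeSemiring.setoid series) using (step-≈-⟩; step-≈-⟨)
  renaming (begin_ to begin≗_; _∎ to _∎≗)

⊕-cong : ∀ {f f′ g g′} → f ≗ f′ → g ≗ g′ → f ⊕ g ≗ f′ ⊕ g′
⊕-cong p q n = cong₂ _+_ (p n) (q n)

⊕-congˡ : ∀ f {g g′} → g ≗ g′ → f ⊕ g ≗ f ⊕ g′
⊕-congˡ f q n = cong (f n +_) (q n)

⊕-congʳ : ∀ g {f f′} → f ≗ f′ → f ⊕ g ≗ f′ ⊕ g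
⊕-congʳ g p n = cong (_+ g n) (p n)

⊛-congˡ : ∀ f {g g′} → g ≗ g′ → f ⊛ g ≗ f ⊛ g′
⊛-congˡ f = ⊛-cong {f} λ _ → refl

⊛-congʳ : ∀ g {f f′} → f ≗ f′ → f ⊛ g ≗ f′ ⊛ g
⊛-congʳ g p = ⊛-cong {g = g} p λ _ → refl

⊕-cancelʳ : ∀ f {g h} → g ⊕ f ≗ h ⊕ f → g ≗ h
⊕-cancelʳ f {g} {h} p n = +-cancelʳ-≡ (f n) (g n) (h n) (p n)

E O : Series
E n = catalan (double n)
O n = catalan (suc (double n))

E-equation : E ≗ 𝟙 ⊕ (X ⊛ (O ⊛ E) ⊕ X ⊛ (O ⊛ E))
E-equation zero    = refl
E-equation (suc n) = begin
  catalan (suc (suc (double n)))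
    ≡⟨ catalan-suc (suc (double n)) ⟩
  ∑ (λ a b → catalan a * catalan b) (suc (double n))
    ≡⟨ ∑-odd (λ a b → catalan a * catalan b) n ⟩
  (E ⊛ O) n + (O ⊛ E) n
    ≡⟨ cong (_+ (O ⊛ E) n) (⊛-comm E O n) ⟩
  (O ⊛ E) n + (O ⊛ E) n
    ≡⟨ cong₂ _+_ (X⊛-suc (O ⊛ E) n) (X⊛-suc (O ⊛ E) n) ⟨
  (X ⊛ (O ⊛ E) ⊕ X ⊛ (O ⊛ E)) (suc n) ∎

O-equation : O ≗ E ⊛ E ⊕ X ⊛ (O ⊛ O)
O-equation zero    = refl
O-equation (suc n) =
  trans (catalan-suc (double (suc n)))
    (trans (∑-even (λ a b → catalan a * catalan b) n)
           (cong ((E ⊛ E) (suc n) +_) (sym (X⊛-suc (O ⊛ O) n))))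

fourTimes : Series → Series
fourTimes f = f ⊕ f ⊕ (f ⊕ f)

-- With z = 2XOE the equation for E reads E = 1 + z, and then 4XE⁴ = 2z + z².
E²-equation : E ⊛ E ≗ 𝟙 ⊕ X ⊛ fourTimes ((E ⊛ E) ⊛ (E ⊛ E))
E²-equation = ⊕-cancelʳ (z ⊛ z) (begin≗
  E ⊛ E ⊕ z ⊛ z
    ≈⟨ ⊕-congʳ (z ⊛ z) (⊛-cong E-equation E-equation) ⟩
  (𝟙 ⊕ z) ⊛ (𝟙 ⊕ z) ⊕ z ⊛ z
    ≈⟨ solve 1 (λ z → (con 1 :+ z) :* (con 1 :+ z) :+ z :* z
                  := con 1 :+ (z :* (con 1 :+ z) :+ z :* (con 1 :+ z))) ≗-refl z ⟩
  𝟙 ⊕ (z ⊛ (𝟙 ⊕ z) ⊕ z ⊛ (𝟙 ⊕ z))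
    ≈⟨ ⊕-congˡ 𝟙 (⊕-cong (⊛-congˡ z E-equation) (⊛-congˡ z E-equation)) ⟨
  𝟙 ⊕ (z ⊛ E ⊕ z ⊛ E)
    ≈⟨ solve 3 (λ x o e →
         con 1 :+ ((x :* (o :* e) :+ x :* (o :* e)) :* e :+ (x :* (o :* e) :+ x :* (o :* e)) :* e)
           := con 1 :+ con 4 :* x :* e :* e :* o) ≗-refl X O E ⟩
  𝟙 ⊕ four ⊛ X ⊛ E ⊛ E ⊛ O
    ≈⟨ ⊕-congˡ 𝟙 (⊛-congˡ (four ⊛ X ⊛ E ⊛ E) O-equation) ⟩
  𝟙 ⊕ four ⊛ X ⊛ E ⊛ E ⊛ (E ⊛ E ⊕ X ⊛ (O ⊛ O))
    ≈⟨ solve 3 (λ x o e →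
         con 1 :+ con 4 :* x :* e :* e :* (e :* e :+ x :* (o :* o))
           := con 1 :+ x :* ((e :* e) :* (e :* e) :+ (e :* e) :* (e :* e) :+ ((e :* e) :* (e :* e) :+ (e :* e) :* (e :* e)))
              :+ (x :* (o :* e) :+ x :* (o :* e)) :* (x :* (o :* e) :+ x :* (o :* e))) ≗-refl X O E ⟩
  𝟙 ⊕ X ⊛ fourTimes ((E ⊛ E) ⊛ (E ⊛ E)) ⊕ z ⊛ z ∎≗)
  where
  z = X ⊛ (O ⊛ E) ⊕ X ⊛ (O ⊛ E)
  four = 𝟙 ⊕ 𝟙 ⊕ 𝟙 ⊕ 𝟙

-- Both sides solve G = 1 + 4XG², which determines the coefficients one after the other; the right
-- side is the Catalan series at 4X.
E²-closed : ∀ n → (E ⊛ E) n ≡ 4 ^ n * catalan n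
E²-closed = <-rec _ step
  where
  lem : ∀ x → x + x + (x + x) ≡ 4 * x
  lem = solve-∀
  lem₂ : ∀ p q x y → (p * x) * (q * y) ≡ p * q * (x * y)
  lem₂ = solve-∀
  lem₃ : ∀ p x → 4 * (p * x) ≡ 4 * p * x
  lem₃ = solve-∀
  step : ∀ n → (∀ {k} → k < n → (E ⊛ E) k ≡ 4 ^ k * catalan k) → (E ⊛ E) n ≡ 4 ^ n * catalan n
  step zero    _  = refl
  step (suc n) ih = begin
    (E ⊛ E) (suc n)
      ≡⟨ E²-equation (suc n) ⟩
    (X ⊛ fourTimes (G ⊛ G)) (suc n)
      ≡⟨ X⊛-suc (fourTimes (G ⊛ G)) n ⟩
    fourTimes (G ⊛ G) n
      ≡⟨ lem ((G ⊛ G) n) ⟩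
    4 * ∑ (λ a b → G a * G b) n
      ≡⟨ cong (4 *_) (∑-cong n λ { a b refl → trans
           (cong₂ _*_ (ih (s≤s (m≤m+n a b))) (ih (s≤s (m≤n+m b a))))
           (trans (lem₂ (4 ^ a) (4 ^ b) (catalan a) (catalan b))
                  (cong (_* (catalan a * catalan b)) (sym (^-distribˡ-+-* 4 a b)))) }) ⟩
    4 * ∑ (λ a b → 4 ^ n * (catalan a * catalan b)) n
      ≡⟨ cong (4 *_) (∑-*ˡ (4 ^ n) (λ a b → catalan a * catalan b) n) ⟩
    4 * (4 ^ n * ∑ (λ a b → catalan a * catalan b) n)
      ≡⟨ lem₃ (4 ^ n) _ ⟩
    4 ^ suc n * ∑ (λ a b → catalan a * catalan b) n
      ≡⟨ cong (4 ^ suc n *_) (catalan-suc n) ⟨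
    4 ^ suc n * catalan (suc n) ∎
    where
    G = E ⊛ E

-- This is O / E = 2E² - O, the series of fillings of rungs of odd size. It arises from `O-equation`
-- multiplied by 2E, where 2XOE is replaced by E - 1.
2E³-equation : (E ⊛ E ⊕ E ⊛ E) ⊛ E ≗ O ⊕ O ⊛ E
2E³-equation = ⊕-cancelʳ (O ⊛ E) (⊕-cancelʳ 2XO²E (begin≗
  (E ⊛ E ⊕ E ⊛ E) ⊛ E ⊕ O ⊛ E ⊕ 2XO²E
    ≈⟨ solve 3 (λ x o e → (e :* e :+ e :* e) :* e :+ o :* e :+ (x :* (o :* o) :+ x :* (o :* o)) :* e
         := (e :* e :+ x :* (o :* o)) :* e :+ (e :* e :+ x :* (o :* o)) :* e :+ o :* e) ≗-refl X O E ⟩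
  (E ⊛ E ⊕ X ⊛ (O ⊛ O)) ⊛ E ⊕ (E ⊛ E ⊕ X ⊛ (O ⊛ O)) ⊛ E ⊕ O ⊛ E
    ≈⟨ ⊕-congʳ (O ⊛ E) (⊕-cong (⊛-congʳ E O-equation) (⊛-congʳ E O-equation)) ⟨
  O ⊛ E ⊕ O ⊛ E ⊕ O ⊛ E
    ≈⟨ ⊕-congˡ (O ⊛ E ⊕ O ⊛ E) (⊛-congˡ O E-equation) ⟩
  O ⊛ E ⊕ O ⊛ E ⊕ O ⊛ (𝟙 ⊕ (X ⊛ (O ⊛ E) ⊕ X ⊛ (O ⊛ E)))
    ≈⟨ solve 3 (λ x o e → o :* e :+ o :* e :+ o :* (con 1 :+ (x :* (o :* e) :+ x :* (o :* e)))
         := o :+ o :* e :+ o :* e :+ (x :* (o :* o) :+ x :* (o :* o)) :* e) ≗-refl X O E ⟩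
  O ⊕ O ⊛ E ⊕ O ⊛ E ⊕ 2XO²E ∎≗))
  where
  2XO²E = (X ⊛ (O ⊛ O) ⊕ X ⊛ (O ⊛ O)) ⊛ E

-- With subtraction it reads E + XO² - 2XOE² = O + 2E - 2E²: the left side is what the cutting
-- yields for the direction 02, the right side is the closed form. It uses 2XOE² = E (E - 1).
cap-equation : E ⊕ X ⊛ (O ⊛ O) ⊕ (E ⊛ E ⊕ E ⊛ E) ≗ O ⊕ (E ⊕ E) ⊕ X ⊛ (O ⊛ (E ⊛ E ⊕ E ⊛ E))
cap-equation = begin≗
  E ⊕ X ⊛ (O ⊛ O) ⊕ (E ⊛ E ⊕ E ⊛ E)
    ≈⟨ solve 3 (λ x o e → e :+ x :* (o :* o) :+ (e :* e :+ e :* e)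
         := (e :* e :+ x :* (o :* o)) :+ (e :+ e :* e)) ≗-refl X O E ⟩
  (E ⊛ E ⊕ X ⊛ (O ⊛ O)) ⊕ (E ⊕ E ⊛ E)
    ≈⟨ ⊕-cong O-equation (⊕-congˡ E (⊛-congˡ E (λ n → sym (E-equation n)))) ⟨
  O ⊕ (E ⊕ E ⊛ (𝟙 ⊕ (X ⊛ (O ⊛ E) ⊕ X ⊛ (O ⊛ E))))
    ≈⟨ solve 3 (λ x o e → o :+ (e :+ e :* (con 1 :+ (x :* (o :* e) :+ x :* (o :* e))))
         := o :+ (e :+ e) :+ x :* (o :* (e :* e :+ e :* e))) ≗-refl X O E ⟩
  O ⊕ (E ⊕ E) ⊕ X ⊛ (O ⊛ (E ⊛ E ⊕ E ⊛ E)) ∎≗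

-- Cutting along the innermost rung

-- When a + b = c + w + 1, exactly one of a ≤ c and b ≤ w holds. For an apex this decides on which
-- side of a nested edge it lies.
∑-split : ∀ h c w → ∑ h (suc (c + w)) ≡
  ∑ (λ a u → h a (u + suc w)) c + ∑ (λ v b → h (suc c + v) b) w
∑-split h zero    w = refl
∑-split h (suc c) w = begin
  h 0 (2 + (c + w)) + ∑ (λ a b → h (suc a) b) (suc (c + w))
    ≡⟨ cong₂ (λ x y → h 0 x + y) (cong suc (sym (+-suc c w))) (∑-split (λ a → h (suc a)) c w) ⟩
  h 0 (suc c + suc w) + (∑ (λ a u → h (suc a) (u + suc w)) c + ∑ (λ v b → h (2 + c + v) b) w)
    ≡⟨ +-assoc (h 0 (suc c + suc w)) _ _ ⟨
  ∑ (λ a u → h a (u + suc w)) (suc c) + ∑ (λ v b → h (suc (suc c) + v) b) w ∎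

-- catalan (u + v) counts the triangulations between an edge and a nested edge that cuts off u
-- vertices on its left and v on its right. The summands distinguish u + v = 0 and the side of the
-- nested edge on which the apex of the outer triangle lies.
both-zero apex-left apex-right : ℕ → ℕ → ℕ
both-zero zero    zero    = 1
both-zero _       _       = 0
apex-left zero    v       = 0
apex-left (suc c) v       = ∑ (λ a u → catalan a * catalan (u + v)) c
apex-right u      zero    = 0
apex-right u      (suc w) = ∑ (λ b v → catalan (u + v) * catalan b) w

catalan-+ : ∀ u v → catalan (u + v) ≡ both-zero u v + (apex-left u v + apex-right u v)
catalan-+ zero    zero    = refl
catalan-+ zero    (suc w) = trans (catalan-suc w) (∑-swap _ w)
catalan-+ (suc c) zero    = begin
  catalan (suc (c + 0)) ≡⟨ cong (λ k → catalan (suc k)) (+-identityʳ c) ⟩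
  catalan (suc c)       ≡⟨ catalan-suc c ⟩
  ∑ (λ a b → catalan a * catalan b) c
    ≡⟨ ∑-cong c (λ a b _ → cong (λ k → catalan a * catalan k) (sym (+-identityʳ b))) ⟩
  apex-left (suc c) 0   ≡⟨ +-identityʳ _ ⟨
  apex-left (suc c) 0 + 0 ∎
catalan-+ (suc c) (suc w) = begin
  catalan (suc (c + suc w))
    ≡⟨ catalan-suc (c + suc w) ⟩
  ∑ cc (c + suc w)
    ≡⟨ cong (∑ cc) (+-suc c w) ⟩
  ∑ cc (suc (c + w))
    ≡⟨ ∑-split cc c w ⟩
  apex-left (suc c) (suc w) + ∑ (λ v b → cc (suc c + v) b) w
    ≡⟨ cong (apex-left (suc c) (suc w) +_) (∑-swap _ w) ⟩
  apex-left (suc c) (suc w) + apex-right (suc c) (suc w) ∎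
  where
  cc : ℕ → ℕ → ℕ
  cc a b = catalan a * catalan b

χ : ℕ → ℕ → ℕ
χ zero    zero    = 1
χ zero    (suc _) = 0
χ (suc _) zero    = 0
χ (suc u) (suc x) = χ u x

χ-refl : ∀ u → χ u u ≡ 1
χ-refl zero    = refl
χ-refl (suc u) = χ-refl u

χ-≢ : ∀ u x → u ≢ x → χ u x ≡ 0
χ-≢ zero    zero    ≢ = contradiction refl ≢
χ-≢ zero    (suc x) ≢ = refl
χ-≢ (suc u) zero    ≢ = refl
χ-≢ (suc u) (suc x) ≢ = χ-≢ u x λ eq → ≢ (cong suc eq)

-- κ δ w is 1 if w = 2v + δ for some v, and 0 otherwise.
κ : ℕ → ℕ → ℕ
κ zero    zero          = 1
κ zero    (suc zero)    = 0
κ zero    (suc (suc w)) = κ zero w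
κ (suc δ) zero          = 0
κ (suc δ) (suc w)       = κ δ w

∑-χ : ∀ δ w → ∑ (λ u v → χ u (δ + v)) w ≡ κ δ w
∑-χ zero    zero          = refl
∑-χ zero    (suc zero)    = refl
∑-χ zero    (suc (suc w)) = begin
  ∑ (λ u v → χ (suc u) v) (suc w)   ≡⟨ ∑-last (λ u v → χ (suc u) v) w ⟩
  ∑ (λ u v → χ u v) w + 0           ≡⟨ +-identityʳ _ ⟩
  ∑ (λ u v → χ u v) w               ≡⟨ ∑-χ zero w ⟩
  κ zero w                          ∎
∑-χ (suc δ) zero          = refl
∑-χ (suc δ) (suc w)       = ∑-χ δ w

κ-even : ∀ c → κ 0 (double c) ≡ 1
κ-even zero    = refl
κ-even (suc c) = κ-even c

κ-odd : ∀ c → κ 0 (suc (double c)) ≡ 0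
κ-odd zero    = refl
κ-odd (suc c) = κ-odd c

κ-0≡2 : ∀ w → κ 0 (suc w) ≡ κ 2 (suc w)
κ-0≡2 zero    = refl
κ-0≡2 (suc w) = refl

-- If (i , δ + d) has the position of a rung, then a nested rung of size e in (i , d) has δ + v
-- vertices on its left and v on its right, where 2v + δ + e = d; g e is its number of fillings.
K-term : ℕ → (ℕ → ℕ) → ℕ → ℕ → ℕ
K-term δ g w e = κ δ w * g e * catalan w

K : ℕ → (ℕ → ℕ) → ℕ → ℕ
K δ g d = ∑ (K-term δ g) d

-- `κ 0` and `κ 2` both select the even widths and differ only at width 0, the term of a rung equal
-- to the base.
K-0≡2 : ∀ g d → K 0 g d ≡ g d + K 2 g d
K-0≡2 g zero    = lem (g 0)
  where
  lem : ∀ x → 1 * x * 1 ≡ x + 0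
  lem = solve-∀
K-0≡2 g (suc n) =
  cong₂ _+_ (lem (g (suc n))) (∑-cong n λ w e _ → cong (λ k → k * g e * catalan (suc w)) (κ-0≡2 w))
  where
  lem : ∀ x → 1 * x * 1 ≡ x
  lem = solve-∀

*-lem₁ : ∀ x y → 1 * x * y ≡ y * x
*-lem₁ = solve-∀

K-even : ∀ g m → K 0 g (double m) ≡ (E ⊛ (λ k → g (double k))) m
K-even g zero    = *-lem₁ (g 0) 1
K-even g (suc m) = begin
  K 0 g (double (suc m))
    ≡⟨ ∑-even (K-term 0 g) m ⟩
  ∑ (λ c d → κ 0 (double c) * g (double d) * E c) (suc m) + ∑ _ m
    ≡⟨ cong₂ _+_
         (∑-cong (suc m) λ c d _ → trans (cong (λ k → k * g (double d) * E c) (κ-even c)) (*-lem₁ (g (double d)) (E c)))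
         (∑-zero m λ c d _ → cong (λ k → k * g (suc (double d)) * O c) (κ-odd c)) ⟩
  (E ⊛ (λ k → g (double k))) (suc m) + 0
    ≡⟨ +-identityʳ _ ⟩
  (E ⊛ (λ k → g (double k))) (suc m) ∎

K-odd : ∀ g m → K 0 g (suc (double m)) ≡ (E ⊛ (λ k → g (suc (double k)))) m
K-odd g m = begin
  K 0 g (suc (double m))
    ≡⟨ ∑-odd (K-term 0 g) m ⟩
  ∑ (λ c d → κ 0 (double c) * g (suc (double d)) * E c) m + ∑ _ m
    ≡⟨ cong₂ _+_
         (∑-cong m λ c d _ → trans (cong (λ k → k * g (suc (double d)) * E c) (κ-even c)) (*-lem₁ (g (suc (double d))) (E c)))
         (∑-zero m λ c d _ → cong (λ k → k * g (double d) * O c) (κ-odd c)) ⟩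
  (E ⊛ (λ k → g (suc (double k)))) m + 0
    ≡⟨ +-identityʳ _ ⟩
  (E ⊛ (λ k → g (suc (double k)))) m ∎

-- `κ 3` selects the odd widths from 3 on; the added term is the missing one of width 1 and
-- completes the convolution with `O`.
K-3-even : ∀ g m → K 3 g (double (suc m)) + g (suc (double m)) ≡ (O ⊛ (λ k → g (suc (double k)))) m
K-3-even g m = begin
  K 3 g (double (suc m)) + g (suc (double m))
    ≡⟨ cong (_+ g (suc (double m))) (∑-even (K-term 3 g) m) ⟩
  ∑ (λ c d → κ 3 (double c) * g (double d) * E c) (suc m) + S + g (suc (double m))
    ≡⟨ cong (λ x → x + S + g (suc (double m)))
         (∑-zero (suc m) λ c d _ → cong (λ k → k * g (double d) * E c) (κ-3-even c)) ⟩
  S + g (suc (double m))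
    ≡⟨ rest m ⟩
  (O ⊛ (λ k → g (suc (double k)))) m ∎
  where
  S = ∑ (λ c d → κ 2 (double c) * g (suc (double d)) * O c) m
  κ-3-even : ∀ c → κ 3 (double c) ≡ 0
  κ-3-even zero          = refl
  κ-3-even (suc zero)    = refl
  κ-3-even (suc (suc c)) = κ-odd c
  lem : ∀ x y → x + y ≡ 1 * y + x
  lem = solve-∀
  rest : ∀ m → ∑ (λ c d → κ 2 (double c) * g (suc (double d)) * O c) m + g (suc (double m))
             ≡ (O ⊛ (λ k → g (suc (double k)))) m
  rest zero    = sym (+-identityʳ (g 1))
  rest (suc m) = trans (lem _ (g (suc (double (suc m)))))
    (cong (1 * g (suc (double (suc m))) +_)
      (∑-cong m λ c d _ → trans (cong (λ k → k * g (suc (double d)) * O (suc c)) (κ-even c)) (*-lem₁ (g (suc (double d))) (O (suc c)))))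

-- A i d stands for the number of triangulations of the polygon i, …, i + d + 1 without a rung,
-- that is, an edge of positive size d whose endpoints add up to s. The base edge is tested too;
-- B i n is the number of those of size n + 1 when it is not.
module Rungs (s : ℕ) (A B : ℕ → ℕ → ℕ)
  (A-zero  : ∀ i → A i 0 ≡ 1)
  (A-rung  : ∀ i n → i + suc (i + suc n) ≡ s → A i (suc n) ≡ 0)
  (A-other : ∀ i n → i + suc (i + suc n) ≢ s → A i (suc n) ≡ B i n)
  (B-apex  : ∀ i n → B i n ≡ ∑ (λ a b → A i a * A (suc (i + a)) b) n)
  where

  Rung : ℕ → ℕ → Set
  Rung p e = p + suc (p + e) ≡ s

  -- An edge of size zero is a side and gets the value 0 even where `Rung i 0` holds. This is why
  -- `b` and `c` must agree at 0 below.
  Z : ℕ → ℕ → ℕ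
  Z i zero    = 0
  Z i (suc n) with i + suc (i + suc n) ≟ s
  ... | yes _ = B i n
  ... | no  _ = 0

  Z-other : ∀ i e → ¬ Rung i e → Z i e ≡ 0
  Z-other i zero    _ = refl
  Z-other i (suc n) ¬r with i + suc (i + suc n) ≟ s
  ... | yes r = contradiction r ¬r
  ... | no  _ = refl

  A+Z≡B : ∀ i n → A i (suc n) + Z i (suc n) ≡ B i n
  A+Z≡B i n with i + suc (i + suc n) ≟ s
  ... | yes r = cong (_+ B i n) (A-rung i n r)
  ... | no ¬r = trans (+-identityʳ _) (A-other i n ¬r)

  -- The triangulations over (i , d) whose innermost rung is (i + u , e), summed over u + v + e = d.
  Y : ℕ → ℕ → ℕ
  Y i d = ∑ (λ u q → ∑ (λ v e → Z (i + u) e * catalan (u + v)) q) d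

  Y-zero : ∀ i d → (∀ u e → u + e ≤ d → ¬ Rung (i + u) e) → Y i d ≡ 0
  Y-zero i d none = ∑-zero d λ { u q refl → ∑-zero q λ { v e refl →
    cong (_* catalan (u + v)) (Z-other (i + u) e (none u e (+-monoʳ-≤ u (m≤n+m e v)))) } }

  -- The two polygons share the vertex k = `suc (i + a)`. Endpoint sums are below 2k in the left one
  -- and above 2k in the right one, so only one of them can reach `s`.
  Y-disjoint : ∀ i a b → Y i a * Y (suc (i + a)) b ≡ 0
  Y-disjoint i a b with ≤-total s (k + k)
    where k = suc (i + a)
  ... | inj₁ s≤2k = trans (cong (Y i a *_) (Y-zero _ b λ u e _ r →
          <-irrefl (sym r) (≤-<-trans s≤2k (right (suc (i + a)) u e)))) (*-zeroʳ (Y i a))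
    where
    right : ∀ k u e → k + k < k + u + suc (k + u + e)
    right k u e = ≤-trans (s≤s (m≤m+n (k + k) (u + (u + e)))) (≤-reflexive (lem k u e))
      where
      lem : ∀ k u e → suc (k + k + (u + (u + e))) ≡ k + u + suc (k + u + e)
      lem = solve-∀
  ... | inj₂ 2k≤s = cong (_* Y (suc (i + a)) b) (Y-zero i a λ u e u+e≤a r →
          <-irrefl r (<-≤-trans (left u e u+e≤a) 2k≤s))
    where
    left : ∀ u e → u + e ≤ a → i + u + suc (i + u + e) < suc (i + a) + suc (i + a)
    left u e le = +-mono-<-≤ (s≤s (+-monoʳ-≤ i (m+n≤o⇒m≤o u le)))
      (s≤s (≤-trans (≤-reflexive (+-assoc i u e)) (+-monoʳ-≤ i le)))

  -- The rung lies to the right of the apex. Choosing the apex before the rung leaves an arbitrary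
  -- polygon to the left of the apex and, to its right, the same kind of sum over a smaller base.
  Y-left : ∀ i n →
    ∑ (λ u q → ∑ (λ v e → Z (i + u) e * apex-left u v) q) (suc n)
      ≡ ∑ (λ a b → catalan a * Y (suc (i + a)) b) n
  Y-left i n = begin
    ∑ (λ v e → Z (i + 0) e * 0) (suc n) + ∑ (λ c q → ∑ (λ v e → Z (i + suc c) e * apex-left (suc c) v) q) n
      ≡⟨ cong (_+ ∑ (λ c q → ∑ (λ v e → Z (i + suc c) e * apex-left (suc c) v) q) n)
           (∑-zero (suc n) λ v e _ → *-zeroʳ (Z (i + 0) e)) ⟩
    ∑ (λ c q → ∑ (λ v e → Z (i + suc c) e * apex-left (suc c) v) q) n
      ≡⟨ ∑-cong n (λ c q _ → ∑-cong q λ v e _ → factor c v e) ⟩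
    ∑ (λ c q → ∑ (λ v e → ∑ (λ a u → h a u v e) c) q) n
      ≡⟨ ∑-cong n (λ c q _ → ∑-exchange (λ a u v e → h a u v e) c q) ⟨
    ∑ (λ c q → ∑ (λ a u → ∑ (λ v e → h a u v e) q) c) n
      ≡⟨ ∑-assoc (λ a u q → ∑ (λ v e → h a u v e) q) n ⟨
    ∑ (λ a b → ∑ (λ u q → ∑ (λ v e → h a u v e) q) b) n
      ≡⟨ ∑-cong n (λ a b _ → trans (∑-cong b λ u q _ → ∑-*ˡ (catalan a) _ q) (∑-*ˡ (catalan a) _ b)) ⟩
    ∑ (λ a b → catalan a * Y (suc (i + a)) b) n ∎
    where
    h : ℕ → ℕ → ℕ → ℕ → ℕ
    h a u v e = catalan a * (Z (suc (i + a) + u) e * catalan (u + v))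
    idx : ∀ i a u → i + suc (a + u) ≡ suc (i + a) + u
    idx = solve-∀
    comm : ∀ x y z → x * (y * z) ≡ y * (x * z)
    comm = solve-∀
    factor : ∀ c v e → Z (i + suc c) e * apex-left (suc c) v ≡ ∑ (λ a u → h a u v e) c
    factor c v e = trans (sym (∑-*ˡ (Z (i + suc c) e) _ c)) (∑-cong c λ { a u refl →
      trans (comm (Z (i + suc (a + u)) e) (catalan a) (catalan (u + v)))
            (cong (λ k → catalan a * (Z k e * catalan (u + v))) (idx i a u)) })

  Y-right : ∀ i n →
    ∑ (λ u q → ∑ (λ v e → Z (i + u) e * apex-right u v) q) (suc n)
      ≡ ∑ (λ a b → Y i a * catalan b) n
  Y-right i n = begin
    ∑ (λ u q → ∑ (λ v e → Z (i + u) e * apex-right u v) q) (suc n)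
      ≡⟨ ∑-last (λ u q → ∑ (λ v e → Z (i + u) e * apex-right u v) q) n ⟩
    ∑ (λ u q → ∑ (λ v e → Z (i + u) e * apex-right u v) (suc q)) n + Z (i + suc n) 0 * 0
      ≡⟨ cong (∑ (λ u q → ∑ (λ v e → Z (i + u) e * apex-right u v) (suc q)) n +_) (*-zeroʳ (Z (i + suc n) 0)) ⟩
    ∑ (λ u q → ∑ (λ v e → Z (i + u) e * apex-right u v) (suc q)) n + 0
      ≡⟨ +-identityʳ _ ⟩
    ∑ (λ u q → ∑ (λ v e → Z (i + u) e * apex-right u v) (suc q)) n
      ≡⟨ ∑-cong n (λ u q _ → cong (_+ ∑ (λ w e → Z (i + u) e * apex-right u (suc w)) q) (*-zeroʳ (Z (i + u) (suc q)))) ⟩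
    ∑ (λ u q → ∑ (λ w e → Z (i + u) e * apex-right u (suc w)) q) n
      ≡⟨ ∑-cong n (λ u q _ → ∑-cong q λ w e _ → factor u w e) ⟩
    ∑ (λ u q → ∑ (λ w e → ∑ (λ b v → h u v e b) w) q) n
      ≡⟨ ∑-cong n (λ u q _ → ∑-assoc (λ b v e → h u v e b) q) ⟨
    ∑ (λ u q → ∑ (λ b r → ∑ (λ v e → h u v e b) r) q) n
      ≡⟨ ∑-cong n (λ u q _ → ∑-swap (λ b r → ∑ (λ v e → h u v e b) r) q) ⟩
    ∑ (λ u q → ∑ (λ r b → ∑ (λ v e → h u v e b) r) q) n
      ≡⟨ ∑-assoc (λ u r b → ∑ (λ v e → h u v e b) r) n ⟩
    ∑ (λ a b → ∑ (λ u r → ∑ (λ v e → h u v e b) r) a) n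
      ≡⟨ ∑-cong n (λ a b _ → trans (∑-cong a λ u r _ → ∑-*ʳ (catalan b) (λ v e → Z (i + u) e * catalan (u + v)) r)
                                   (∑-*ʳ (catalan b) (λ u r → ∑ (λ v e → Z (i + u) e * catalan (u + v)) r) a)) ⟩
    ∑ (λ a b → Y i a * catalan b) n ∎
    where
    h : ℕ → ℕ → ℕ → ℕ → ℕ
    h u v e b = Z (i + u) e * catalan (u + v) * catalan b
    factor : ∀ u w e → Z (i + u) e * apex-right u (suc w) ≡ ∑ (λ b v → h u v e b) w
    factor u w e = trans (sym (∑-*ˡ (Z (i + u) e) (λ b v → catalan (u + v) * catalan b) w))
      (∑-cong w λ b v _ → sym (*-assoc (Z (i + u) e) (catalan (u + v)) (catalan b)))

  Y-both-zero : ∀ i n →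
    ∑ (λ u q → ∑ (λ v e → Z (i + u) e * both-zero u v) q) (suc n) ≡ Z i (suc n)
  Y-both-zero i n = begin
    Z (i + 0) (suc n) * 1 + ∑ (λ v e → Z (i + 0) e * 0) n + ∑ (λ c q → ∑ (λ v e → Z (i + suc c) e * 0) q) n
      ≡⟨ cong₂ (λ x y → Z (i + 0) (suc n) * 1 + x + y)
           (∑-zero n λ v e _ → *-zeroʳ (Z (i + 0) e))
           (∑-zero n λ c q _ → ∑-zero q λ v e _ → *-zeroʳ (Z (i + suc c) e)) ⟩
    Z (i + 0) (suc n) * 1 + 0 + 0
      ≡⟨ lem (Z (i + 0) (suc n)) ⟩
    Z (i + 0) (suc n)
      ≡⟨ cong (λ k → Z k (suc n)) (+-identityʳ i) ⟩
    Z i (suc n) ∎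
    where
    lem : ∀ x → x * 1 + 0 + 0 ≡ x
    lem = solve-∀

  -- Decomposing the outer factor by `catalan-+` removes the triangle on the base: either the base
  -- is the innermost rung, or that rung lies on one side of the apex.
  Y-suc : ∀ i n → Y i (suc n) ≡
    Z i (suc n) + (∑ (λ a b → catalan a * Y (suc (i + a)) b) n + ∑ (λ a b → Y i a * catalan b) n)
  Y-suc i n = begin
    Y i (suc n)
      ≡⟨ ∑-cong (suc n) (λ u q _ → trans
           (∑-cong q λ v e _ → trans (cong (Z (i + u) e *_) (catalan-+ u v))
              (dist (Z (i + u) e) (both-zero u v) (apex-left u v) (apex-right u v)))
           (split (z both-zero u) (z apex-left u) (z apex-right u) q)) ⟩
    ∑ (λ u q → ∑ (z both-zero u) q + (∑ (z apex-left u) q + ∑ (z apex-right u) q)) (suc n)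
      ≡⟨ split (λ u q → ∑ (z both-zero u) q) (λ u q → ∑ (z apex-left u) q) (λ u q → ∑ (z apex-right u) q) (suc n) ⟩
    _ ≡⟨ cong₂ _+_ (Y-both-zero i n) (cong₂ _+_ (Y-left i n) (Y-right i n)) ⟩
    Z i (suc n) + (∑ (λ a b → catalan a * Y (suc (i + a)) b) n + ∑ (λ a b → Y i a * catalan b) n) ∎
    where
    z : (ℕ → ℕ → ℕ) → ℕ → ℕ → ℕ → ℕ
    z g u v e = Z (i + u) e * g u v
    dist : ∀ x a b c → x * (a + (b + c)) ≡ x * a + (x * b + x * c)
    dist = solve-∀
    split : ∀ h k l n → ∑ (λ a b → h a b + (k a b + l a b)) n ≡ ∑ h n + (∑ k n + ∑ l n)
    split h k l n = trans (∑-+ h (λ a b → k a b + l a b) n) (cong (∑ h n +_) (∑-+ k l n))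

  -- Segner's recurrence with both factors expanded as A + Y. The terms without Y form the
  -- recurrence of `A`, where `Z` restores the excluded base. The others form that of `Y`, which
  -- contains the product Y Y′ twice instead of once; `Y-disjoint` makes this harmless.
  innermost : ∀ d i → catalan d ≡ A i d + Y i d
  innermost = <-rec _ step
    where
    step : ∀ d → (∀ {k} → k < d → ∀ i → catalan k ≡ A i k + Y i k) → ∀ i → catalan d ≡ A i d + Y i d
    step zero    _  i = sym (cong (_+ Y i 0) (A-zero i))
    step (suc n) ih i = begin
      catalan (suc n)
        ≡⟨ catalan-suc n ⟩
      ∑ (λ a b → catalan a * catalan b) n
        ≡⟨ ∑-cong n (λ { a b refl → apex a b (ih (s≤s (m≤m+n a b)) i) (ih (s≤s (m≤n+m b a)) (suc (i + a))) }) ⟩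
      ∑ (λ a b → A i a * A (suc (i + a)) b + (catalan a * Y (suc (i + a)) b + Y i a * catalan b)) n
        ≡⟨ trans (∑-+ _ _ n) (cong (∑ (λ a b → A i a * A (suc (i + a)) b) n +_) (∑-+ _ _ n)) ⟩
      ∑ (λ a b → A i a * A (suc (i + a)) b) n + S
        ≡⟨ cong (_+ S) (trans (A+Z≡B i n) (B-apex i n)) ⟨
      A i (suc n) + Z i (suc n) + S
        ≡⟨ +-assoc (A i (suc n)) (Z i (suc n)) S ⟩
      A i (suc n) + (Z i (suc n) + S)
        ≡⟨ cong (A i (suc n) +_) (Y-suc i n) ⟨
      A i (suc n) + Y i (suc n) ∎
      where
      S = ∑ (λ a b → catalan a * Y (suc (i + a)) b) n + ∑ (λ a b → Y i a * catalan b) n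
      expand : ∀ a y a′ y′ → (a + y) * (a′ + y′) + y * y′ ≡ a * a′ + ((a + y) * y′ + y * (a′ + y′))
      expand = solve-∀
      apex : ∀ a b → catalan a ≡ A i a + Y i a → catalan b ≡ A (suc (i + a)) b + Y (suc (i + a)) b →
        catalan a * catalan b ≡
          A i a * A (suc (i + a)) b + (catalan a * Y (suc (i + a)) b + Y i a * catalan b)
      apex a b p q rewrite p | q = trans (sym (+-identityʳ _))
        (trans (cong ((A i a + Y i a) * (A (suc (i + a)) b + Y (suc (i + a)) b) +_) (sym (Y-disjoint i a b)))
               (expand (A i a) (Y i a) (A (suc (i + a)) b) (Y (suc (i + a)) b)))

  -- The outer factor `catalan (u + v)` depends only on the width `w = u + v`, so the positions of a
  -- rung of size `e` can be collected for each width.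
  W : ℕ → ℕ → ℕ → ℕ
  W i w e = ∑ (λ u _ → Z (i + u) e) w

  Y-by-width : ∀ i d → Y i d ≡ ∑ (λ w e → W i w e * catalan w) d
  Y-by-width i d = trans (∑-assoc (λ u v e → Z (i + u) e * catalan (u + v)) d)
    (∑-cong d λ w e _ → trans (∑-cong w λ { u v refl → refl })
                              (∑-*ʳ (catalan w) (λ u _ → Z (i + u) e) w))

  -- The number of fillings of a rung of size e is b e − c e, stated without subtraction.
  module Values (b c : ℕ → ℕ) (b0≡c0 : b 0 ≡ c 0)
    (balance : ∀ p n → Rung p (suc n) → catalan (suc n) + K 0 c (suc n) ≡ K 0 b (suc n)) where

    -- For a given width and size the endpoint sum forces u = δ + v, so at most one position is a
    -- rung, and `κ δ w` tells whether there is one.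
    W-value : ∀ i δ w e → Rung i (δ + (w + e)) → (∀ p → Rung p e → Z p e + c e ≡ b e) →
      W i w e + κ δ w * c e ≡ κ δ w * b e
    W-value i δ w e r val = begin
      W i w e + κ δ w * c e
        ≡⟨ cong (λ k → W i w e + k * c e) (∑-χ δ w) ⟨
      W i w e + ∑ (λ u v → χ u (δ + v)) w * c e
        ≡⟨ cong (W i w e +_) (∑-*ʳ (c e) (λ u v → χ u (δ + v)) w) ⟨
      W i w e + ∑ (λ u v → χ u (δ + v) * c e) w
        ≡⟨ ∑-+ (λ u _ → Z (i + u) e) (λ u v → χ u (δ + v) * c e) w ⟨
      ∑ (λ u v → Z (i + u) e + χ u (δ + v) * c e) w
        ≡⟨ ∑-cong w pointwise ⟩
      ∑ (λ u v → χ u (δ + v) * b e) w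
        ≡⟨ ∑-*ʳ (b e) (λ u v → χ u (δ + v)) w ⟩
      ∑ (λ u v → χ u (δ + v)) w * b e
        ≡⟨ cong (_* b e) (∑-χ δ w) ⟩
      κ δ w * b e ∎
      where
      lem₁ : ∀ i δ v e → (i + (δ + v)) + suc ((i + (δ + v)) + e) ≡ i + suc (i + (δ + ((δ + v) + v + e)))
      lem₁ = solve-∀
      lem₂ : ∀ i u e → (i + u) + suc ((i + u) + e) ≡ u + (suc (i + i) + (u + e))
      lem₂ = solve-∀
      lem₃ : ∀ i δ u v e → i + suc (i + (δ + (u + v + e))) ≡ (δ + v) + (suc (i + i) + (u + e))
      lem₃ = solve-∀
      pointwise : ∀ u v → u + v ≡ w → Z (i + u) e + χ u (δ + v) * c e ≡ χ u (δ + v) * b e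
      pointwise u v refl with u ≟ δ + v
      ... | yes refl rewrite χ-refl (δ + v) =
        trans (cong (Z (i + (δ + v)) e +_) (*-identityˡ (c e)))
          (trans (val (i + (δ + v)) (trans (lem₁ i δ v e) r)) (sym (*-identityˡ (b e))))
      ... | no u≢ rewrite χ-≢ u (δ + v) u≢ = trans (+-identityʳ _) (Z-other (i + u) e λ r′ →
        u≢ (+-cancelʳ-≡ (suc (i + i) + (u + e)) u (δ + v)
          (trans (sym (lem₂ i u e)) (trans r′ (trans (sym r) (lem₃ i δ u v e))))))

    private
      *-combine : ∀ x y z c → x + y ≡ z → x * c + y * c ≡ z * c
      *-combine x y z c p = trans (sym (*-distribʳ-+ c x y)) (cong (_* c) p)

    -- At a rung `A` is 0 and `innermost` equates `catalan` with `Y`. The term of width 0 is the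
    -- unknown, all others have smaller size, and `balance` says that b - c solves the same
    -- triangular system.
    rung-value : ∀ e p → Rung p e → Z p e + c e ≡ b e
    rung-value = <-rec _ step
      where
      step : ∀ e → (∀ {k} → k < e → ∀ p → Rung p k → Z p k + c k ≡ b k) → ∀ p → Rung p e → Z p e + c e ≡ b e
      step zero    _  p r = sym b0≡c0
      step (suc n) ih p r = +-cancelʳ-≡ (rest b) _ _ (begin
        Z p (suc n) + c (suc n) + rest b
          ≡⟨ cong (Z p (suc n) + c (suc n) +_) rest-≡ ⟨
        Z p (suc n) + c (suc n) + (restY + rest c)
          ≡⟨ cong (λ k → Z k (suc n) + c (suc n) + (restY + rest c)) (+-identityʳ p) ⟨
        Z (p + 0) (suc n) + c (suc n) + (restY + rest c)
          ≡⟨ lem (Z (p + 0) (suc n)) (c (suc n)) restY (rest c) ⟩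
        (Z (p + 0) (suc n) * 1 + restY) + (1 * c (suc n) * 1 + rest c)
          ≡⟨ cong (_+ K 0 c (suc n)) (Y-by-width p (suc n)) ⟨
        Y p (suc n) + K 0 c (suc n)
          ≡⟨ cong (_+ K 0 c (suc n)) (trans (innermost (suc n) p) (cong (_+ Y p (suc n)) (A-rung p n r))) ⟨
        catalan (suc n) + K 0 c (suc n)
          ≡⟨ balance p n r ⟩
        1 * b (suc n) * 1 + rest b
          ≡⟨ cong (_+ rest b) (lem₂ (b (suc n))) ⟩
        b (suc n) + rest b ∎)
        where
        rest : (ℕ → ℕ) → ℕ
        rest g = ∑ (λ w e → κ 0 (suc w) * g e * catalan (suc w)) n
        restY = ∑ (λ w e → W p (suc w) e * catalan (suc w)) n
        lem : ∀ z c x y → z + c + (x + y) ≡ (z * 1 + x) + (1 * c * 1 + y)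
        lem = solve-∀
        lem₂ : ∀ x → 1 * x * 1 ≡ x
        lem₂ = solve-∀
        rest-≡ : restY + rest c ≡ rest b
        rest-≡ = trans (sym (∑-+ _ _ n)) (∑-cong n λ { w e refl →
          *-combine (W p (suc w) e) (κ 0 (suc w) * c e) (κ 0 (suc w) * b e) (catalan (suc w))
            (W-value p 0 (suc w) e r (ih (s≤s (m≤n+m e w)))) })

    Y-value : ∀ i δ d → Rung i (δ + d) → Y i d + K δ c d ≡ K δ b d
    Y-value i δ d r = begin
      Y i d + K δ c d
        ≡⟨ cong (_+ K δ c d) (Y-by-width i d) ⟩
      ∑ (λ w e → W i w e * catalan w) d + K δ c d
        ≡⟨ ∑-+ _ _ d ⟨
      ∑ (λ w e → W i w e * catalan w + κ δ w * c e * catalan w) d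
        ≡⟨ ∑-cong d (λ { w e refl →
             *-combine (W i w e) (κ δ w * c e) (κ δ w * b e) (catalan w) (W-value i δ w e r (rung-value e)) }) ⟩
      K δ b d ∎

    A-value : ∀ i δ d → Rung i (δ + d) → A i d + K δ b d ≡ catalan d + K δ c d
    A-value i δ d r = begin
      A i d + K δ b d             ≡⟨ cong (A i d +_) (Y-value i δ d r) ⟨
      A i d + (Y i d + K δ c d)   ≡⟨ +-assoc (A i d) (Y i d) (K δ c d) ⟨
      A i d + Y i d + K δ c d     ≡⟨ cong (_+ K δ c d) (innermost d i) ⟨
      catalan d + K δ c d         ∎

    -- The result is the filling number of a rung of size `d`. Geometrically, the rungs here are the
    -- diagonals parallel to the side (i , i + 1) of a (d + 2)-gon, and rotating by one vertex
    -- carries this side to the base.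
    A-value-2 : ∀ i d → Rung i (2 + d) → catalan d + K 0 c d ≡ K 0 b d → A i d + c d ≡ b d
    A-value-2 i d r bal = +-cancelʳ-≡ (K 2 b d) _ _ (begin
      A i d + c d + K 2 b d         ≡⟨ lem (A i d) (c d) (K 2 b d) ⟩
      A i d + K 2 b d + c d         ≡⟨ cong (_+ c d) (A-value i 2 d r) ⟩
      catalan d + K 2 c d + c d     ≡⟨ lem₂ (catalan d) (K 2 c d) (c d) ⟩
      catalan d + (c d + K 2 c d)   ≡⟨ cong (catalan d +_) (K-0≡2 c d) ⟨
      catalan d + K 0 c d           ≡⟨ bal ⟩
      K 0 b d                       ≡⟨ K-0≡2 b d ⟩
      b d + K 2 b d                 ∎)
      where
      lem : ∀ x y z → x + y + z ≡ x + z + y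
      lem = solve-∀
      lem₂ : ∀ x y z → x + y + z ≡ x + (z + y)
      lem₂ = solve-∀

-- Parity of rung sizes and the closed forms of the fillings

data EvenOdd : ℕ → Set where
  even : ∀ m → EvenOdd (double m)
  odd  : ∀ m → EvenOdd (suc (double m))

evenOrOdd : ∀ n → EvenOdd n
evenOrOdd zero    = even 0
evenOrOdd (suc n) with evenOrOdd n
... | even m = odd m
... | odd  m = even (suc m)

double≢1+double : ∀ a b → double a ≢ suc (double b)
double≢1+double (suc a) (suc b) eq = double≢1+double a b (suc-injective (suc-injective eq))

p+1+p+e : ∀ p e → p + suc (p + e) ≡ suc (double p + e)
p+1+p+e p e = trans (lem p e) (cong (λ k → suc (k + e)) (sym (double≡2* p)))
  where
  lem : ∀ p e → p + suc (p + e) ≡ suc (2 * p + e)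
  lem = solve-∀

double-+ : ∀ a b → double a + double b ≡ double (a + b)
double-+ zero    b = refl
double-+ (suc a) b = cong (λ k → suc (suc k)) (double-+ a b)

⌊1+double/2⌋ : ∀ m → ⌊ suc (double m) /2⌋ ≡ m
⌊1+double/2⌋ zero    = refl
⌊1+double/2⌋ (suc m) = cong suc (⌊1+double/2⌋ m)

-- At even sizes `b₁` is the series 2XO. At odd sizes `b₂` is 2E² by `E²-closed`, and is paired with
-- `catalan` as its `c`, which it equals at size 0.
b₁ c₁ b₂ : ℕ → ℕ
b₁ zero    = 0
b₁ (suc k) = 2 * catalan k
c₁ _       = 0
b₂ e       = 2 ^ e * catalan ⌊ e /2⌋

balance₁ : ∀ m → catalan (double (suc m)) + K 0 c₁ (double (suc m)) ≡ K 0 b₁ (double (suc m))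
balance₁ m = begin
  E (suc m) + K 0 c₁ (double (suc m))
    ≡⟨ cong (E (suc m) +_) (∑-zero (double (suc m)) λ w e _ → cong (_* catalan w) (*-zeroʳ (κ 0 w))) ⟩
  E (suc m) + 0
    ≡⟨ +-identityʳ _ ⟩
  E (suc m)
    ≡⟨ E-equation (suc m) ⟩
  (X ⊛ (O ⊛ E)) (suc m) + (X ⊛ (O ⊛ E)) (suc m)
    ≡⟨ cong (λ k → k + k) (X⊛-suc (O ⊛ E) m) ⟩
  (O ⊛ E) m + (O ⊛ E) m
    ≡⟨ cong ((O ⊛ E) m +_) (+-identityʳ _) ⟨
  2 * (O ⊛ E) m
    ≡⟨ ∑-*ˡ 2 (λ a b → O a * E b) m ⟨
  ∑ (λ a b → 2 * (O a * E b)) m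
    ≡⟨ ∑-cong m (λ a b _ → sym (*-assoc 2 (O a) (E b))) ⟩
  ((λ k → b₁ (double k)) ⊛ E) (suc m)
    ≡⟨ ⊛-comm (λ k → b₁ (double k)) E (suc m) ⟩
  (E ⊛ (λ k → b₁ (double k))) (suc m)
    ≡⟨ K-even b₁ (suc m) ⟨
  K 0 b₁ (double (suc m)) ∎

b₂-odd : ∀ m → b₂ (suc (double m)) ≡ (E ⊛ E ⊕ E ⊛ E) m
b₂-odd m = begin
  2 ^ suc (double m) * catalan ⌊ suc (double m) /2⌋
    ≡⟨ cong₂ (λ x y → 2 * 2 ^ x * catalan y) (double≡2* m) (⌊1+double/2⌋ m) ⟩
  2 * 2 ^ (2 * m) * catalan m
    ≡⟨ cong (λ x → 2 * x * catalan m) (^-*-assoc 2 2 m) ⟨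
  2 * 4 ^ m * catalan m
    ≡⟨ lem (4 ^ m) (catalan m) ⟩
  4 ^ m * catalan m + 4 ^ m * catalan m
    ≡⟨ cong (λ k → k + k) (E²-closed m) ⟨
  (E ⊛ E ⊕ E ⊛ E) m ∎
  where
  lem : ∀ x y → 2 * x * y ≡ x * y + x * y
  lem = solve-∀

balance₂ : ∀ m → catalan (suc (double m)) + K 0 catalan (suc (double m)) ≡ K 0 b₂ (suc (double m))
balance₂ m = begin
  O m + K 0 catalan (suc (double m))
    ≡⟨ cong (O m +_) (trans (K-odd catalan m) (⊛-comm E O m)) ⟩
  O m + (O ⊛ E) m
    ≡⟨ 2E³-equation m ⟨
  ((E ⊛ E ⊕ E ⊛ E) ⊛ E) m
    ≡⟨ ⊛-congʳ E b₂-odd m ⟨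
  ((λ k → b₂ (suc (double k))) ⊛ E) m
    ≡⟨ ⊛-comm (λ k → b₂ (suc (double k))) E m ⟩
  (E ⊛ (λ k → b₂ (suc (double k)))) m
    ≡⟨ K-odd b₂ m ⟨
  K 0 b₂ (suc (double m)) ∎

-- An odd endpoint sum forces an even rung size, which leaves only the case of `balance₁`;
-- `balance₂-rung` is the opposite parity.
balance₁-rung : ∀ t p n → p + suc (p + suc n) ≡ suc (double t) →
  catalan (suc n) + K 0 c₁ (suc n) ≡ K 0 b₁ (suc n)
balance₁-rung t p n r with evenOrOdd n
... | odd  m = balance₁ m
... | even m = contradiction (suc-injective (trans (sym r) (p+1+p+e p (suc (double m))))) λ eq →
  double≢1+double t (p + m) (trans eq (trans (+-suc (double p) (double m)) (cong suc (double-+ p m))))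

balance₂-rung : ∀ t p n → p + suc (p + suc n) ≡ double t →
  catalan (suc n) + K 0 catalan (suc n) ≡ K 0 b₂ (suc n)
balance₂-rung t p n r with evenOrOdd n
... | even m = balance₂ m
... | odd  m = contradiction (trans (sym r) (trans (p+1+p+e p (double (suc m))) (cong suc (double-+ p (suc m)))))
  (double≢1+double t (p + suc m))

-- Triangulations as binary trees

data Tree : Set where
  leaf : Tree
  node : Tree → Tree → Tree

nodes : Tree → ℕ
nodes leaf       = 0
nodes (node l r) = suc (nodes l + nodes r)

-- A tree with n nodes placed at i is a triangulation of the polygon i, i+1, …, i+n+1; the
-- root is the triangle on the base edge (i , top i n).
top : ℕ → ℕ → ℕ
top i n = suc (i + n)

-- A leaf is a side and contributes no edge. `inner` omits the base, which for the whole polygon is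
-- a side too.
edges inner : ℕ → Tree → List Segment
edges i leaf       = []
edges i (node l r) = (i , top i (suc (nodes l + nodes r))) ∷ (edges i l ++ edges (top i (nodes l)) r)
inner i leaf       = []
inner i (node l r) = edges i l ++ edges (top i (nodes l)) r

top-top : ∀ i a b → top (top i a) b ≡ top i (suc (a + b))
top-top i a b = lem i a b
  where
  lem : ∀ i a b → suc (suc (i + a) + b) ≡ suc (i + suc (a + b))
  lem = solve-∀

i<top : ∀ i n → i < top i n
i<top i n = s≤s (m≤m+n i n)

1+i<top⇒0<n : ∀ i n → suc i < top i n → 0 < n
1+i<top⇒0<n i n lt = +-cancelˡ-< i 0 n (subst (_< i + n) (sym (+-identityʳ i)) (s<s⁻¹ lt))

base∈edges : ∀ i t → 0 < nodes t → (i , top i (nodes t)) ∈ edges i t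
base∈edges i (node l r) _ = here refl

edges-within : ∀ i t {a b} → (a , b) ∈ edges i t → i ≤ a × suc a < b × b ≤ top i (nodes t)
edges-within i (node l r) (here refl) = ≤-refl , s≤s (m<m+n i z<s) , ≤-refl
edges-within i (node l r) (there e∈) with ∈-++⁻ (edges i l) e∈
... | inj₁ e∈l =
  let i≤a , a<b , b≤ = edges-within i l e∈l
  in i≤a , a<b , ≤-trans b≤ (s≤s (+-monoʳ-≤ i (≤-trans (m≤m+n _ _) (n≤1+n _))))
... | inj₂ e∈r =
  let k≤a , a<b , b≤ = edges-within (top i (nodes l)) r e∈r
  in ≤-trans (<⇒≤ (i<top i (nodes l))) k≤a , a<b , ≤-trans b≤ (≤-reflexive (top-top i (nodes l) (nodes r)))

inner⊆edges : ∀ i t → inner i t ⊆ edges i t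
inner⊆edges i (node l r) = there

edges⇒inner : ∀ i t {e} → e ∈ edges i t → e ≢ (i , top i (nodes t)) → e ∈ inner i t
edges⇒inner i (node l r) (here e≡) e≢ = contradiction e≡ e≢
edges⇒inner i (node l r) (there e∈) _ = e∈

inner-proper : ∀ i t {a b} → (a , b) ∈ inner i t → a ≡ i → b < top i (nodes t)
inner-proper i (node l r) e∈ refl with ∈-++⁻ (edges i l) e∈
... | inj₁ e∈l = ≤-<-trans (proj₂ (proj₂ (edges-within i l e∈l))) (s≤s (+-monoʳ-< i (s≤s (m≤m+n _ _))))
... | inj₂ e∈r = contradiction (proj₁ (edges-within (top i (nodes l)) r e∈r)) (<⇒≱ (i<top i (nodes l)))

outside-¬Crossing : ∀ {i j c d} → i ≤ c → d ≤ j → ¬ Crossing (i , j) (c , d)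
outside-¬Crossing _   d≤j (inj₁ (_ , _ , j<d)) = <⇒≱ j<d d≤j
outside-¬Crossing i≤c _   (inj₂ (c<i , _))     = <⇒≱ c<i i≤c

separated-¬Crossing : ∀ {a b c d k} → b ≤ k → k ≤ c → ¬ Crossing (a , b) (c , d)
separated-¬Crossing b≤k k≤c (inj₁ (_ , c<b , _)) = <⇒≱ c<b (≤-trans b≤k k≤c)
separated-¬Crossing b≤k k≤c (inj₂ (c<a , a<d , d<b)) =
  <⇒≱ (<-trans c<a (<-trans a<d d<b)) (≤-trans b≤k k≤c)

edges-¬Crossing : ∀ i t {d e} → d ∈ edges i t → e ∈ edges i t → ¬ Crossing d e
edges-¬Crossing i t@(node l r) (here refl) e∈ =
  let i≤c , _ , d≤j = edges-within i t e∈ in outside-¬Crossing i≤c d≤j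
edges-¬Crossing i t@(node l r) (there d∈) (here refl) cr =
  let i≤c , _ , d≤j = edges-within i t (there d∈) in outside-¬Crossing i≤c d≤j (swap cr)
edges-¬Crossing i (node l r) (there d∈) (there e∈) with ∈-++⁻ (edges i l) d∈ | ∈-++⁻ (edges i l) e∈
... | inj₁ d∈l | inj₁ e∈l = edges-¬Crossing i l d∈l e∈l
... | inj₂ d∈r | inj₂ e∈r = edges-¬Crossing (top i (nodes l)) r d∈r e∈r
... | inj₁ d∈l | inj₂ e∈r =
  separated-¬Crossing (proj₂ (proj₂ (edges-within i l d∈l))) (proj₁ (edges-within (top i (nodes l)) r e∈r))
... | inj₂ d∈r | inj₁ e∈l = λ cr →
  separated-¬Crossing (proj₂ (proj₂ (edges-within i l e∈l))) (proj₁ (edges-within (top i (nodes l)) r d∈r)) (swap cr)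

Blocked : List Segment → Segment → Set
Blocked S d = d ∈ S ⊎ ∃[ e ] e ∈ S × Crossing d e

Blocked-mono : ∀ {S T d} → S ⊆ T → Blocked S d → Blocked T d
Blocked-mono S⊆T (inj₁ d∈)            = inj₁ (S⊆T d∈)
Blocked-mono S⊆T (inj₂ (e , e∈ , cr)) = inj₂ (e , S⊆T e∈ , cr)

InnerBlocked : ℕ → Tree → Set
InnerBlocked i t = ∀ {a b} → i ≤ a → suc a < b → b ≤ top i (nodes t) →
  (a , b) ≢ (i , top i (nodes t)) → Blocked (inner i t) (a , b)

edges-blocked : ∀ i t → InnerBlocked i t → ∀ {a b} → i ≤ a → suc a < b → b ≤ top i (nodes t) →
                Blocked (edges i t) (a , b)
edges-blocked i t blocked {a} {b} i≤a a<b b≤ with (a , b) ≟ˢ (i , top i (nodes t))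
... | no  ≢    = Blocked-mono (inner⊆edges i t) (blocked i≤a a<b b≤ ≢)
... | yes refl = inj₁ (base∈edges i t (1+i<top⇒0<n i (nodes t) a<b))

-- An edge within neither subpolygon passes over the apex `k`. If it starts after `i` it crosses the
-- left side of the root triangle; if it starts at `i` it ends before the far end, not being the
-- base, and crosses the right side.
inner-blocked : ∀ i t → InnerBlocked i t
inner-blocked i leaf i≤a a<b b≤ _ =
  contradiction (≤-trans a<b (≤-trans b≤ (≤-reflexive (cong suc (+-identityʳ i))))) (≤⇒≯ (s≤s i≤a))
inner-blocked i (node l r) {a} {b} i≤a a<b b≤ ≢base with b ≤? k | k ≤? a
  where k = top i (nodes l)
... | yes b≤k | _ = Blocked-mono ∈-++⁺ˡ (edges-blocked i l (inner-blocked i l) i≤a a<b b≤k)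
... | no _ | yes k≤a =
  Blocked-mono (∈-++⁺ʳ (edges i l))
    (edges-blocked (top i (nodes l)) r (inner-blocked (top i (nodes l)) r) k≤a a<b (≤-trans b≤ (≤-reflexive (sym (top-top i (nodes l) (nodes r))))))
... | no b≰k | no k≰a with i <? a
...   | yes i<a = inj₂ ((i , top i (nodes l)) ,
          ∈-++⁺ˡ (base∈edges i l (1+i<top⇒0<n i (nodes l) (≤-<-trans i<a (≰⇒> k≰a)))) ,
          inj₂ (i<a , ≰⇒> k≰a , ≰⇒> b≰k))
...   | no i≮a = inj₂ ((k , top k (nodes r)) ,
          ∈-++⁺ʳ (edges i l) (base∈edges k r (1+i<top⇒0<n k (nodes r) (≤-<-trans (≰⇒> b≰k) b<top))) ,
          inj₁ (≰⇒> k≰a , ≰⇒> b≰k , b<top))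
  where
  k = top i (nodes l)
  b<top : b < top k (nodes r)
  b<top = subst (b <_) (sym (top-top i (nodes l) (nodes r)))
    (≤∧≢⇒< b≤ λ b≡ → ≢base (cong₂ _,_ (≤-antisym (≮⇒≥ i≮a) i≤a) b≡))

-- Two trees with different apexes over the same base have crossing edges.
inner-injective : ∀ i t t′ → nodes t ≡ nodes t′ → inner i t ⊆ inner i t′ → t ≡ t′
inner-injective i leaf       leaf         _  _   = refl
inner-injective i (node l r) (node l′ r′) eq sub with <-cmp (nodes l) (nodes l′)
... | tri< lt _ _ = contradiction (inj₂ (i<top i (nodes l) , s≤s (+-monoʳ-< i lt) , top<)) (edges-¬Crossing i (node l′ r′)
        (there (sub (∈-++⁺ʳ (edges i l) (base∈edges k r r>0))))
        (there (∈-++⁺ˡ (base∈edges i l′ (≤-<-trans z≤n lt)))))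
  where
  k = top i (nodes l)
  r>0 : 0 < nodes r
  r>0 = +-cancelˡ-< (nodes l) 0 (nodes r) (subst₂ _<_ (sym (+-identityʳ _)) (sym (suc-injective eq))
          (<-≤-trans lt (m≤m+n (nodes l′) (nodes r′))))
  top< : top i (nodes l′) < top k (nodes r)
  top< = subst (top i (nodes l′) <_) (sym (top-top i (nodes l) (nodes r)))
    (s≤s (+-monoʳ-< i (subst (nodes l′ <_) (sym eq) (s≤s (m≤m+n (nodes l′) (nodes r′))))))
... | tri> _ _ gt = contradiction (inj₁ (i<top i (nodes l′) , s≤s (+-monoʳ-< i gt) , top<)) (edges-¬Crossing i (node l′ r′)
        (there (sub (∈-++⁺ˡ (base∈edges i l (≤-<-trans z≤n gt)))))
        (there (∈-++⁺ʳ (edges i l′) (base∈edges k′ r′ r′>0))))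
  where
  k′ = top i (nodes l′)
  r′>0 : 0 < nodes r′
  r′>0 = +-cancelˡ-< (nodes l′) 0 (nodes r′) (subst₂ _<_ (sym (+-identityʳ _)) (suc-injective eq)
          (<-≤-trans gt (m≤m+n (nodes l) (nodes r))))
  top< : top i (nodes l) < top k′ (nodes r′)
  top< = subst (top i (nodes l) <_) (sym (top-top i (nodes l′) (nodes r′)))
    (s≤s (+-monoʳ-< i (subst (nodes l <_) eq (s≤s (m≤m+n (nodes l) (nodes r))))))
... | tri≈ _ l≡l′ _ = cong₂ node
        (inner-injective i l l′ l≡l′ subˡ)
        (inner-injective (top i (nodes l)) r r′ r≡r′ subʳ)
  where
  r≡r′ : nodes r ≡ nodes r′
  r≡r′ = +-cancelˡ-≡ (nodes l′) _ _ (subst (λ x → x + nodes r ≡ nodes l′ + nodes r′) l≡l′ (suc-injective eq))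
  subˡ : inner i l ⊆ inner i l′
  subˡ {a , b} e∈ with ∈-++⁻ (edges i l′) (sub (∈-++⁺ˡ (inner⊆edges i l e∈)))
  ... | inj₁ e∈l′ = edges⇒inner i l′ e∈l′ λ { refl →
          <-irrefl (cong (top i) (sym l≡l′)) (inner-proper i l e∈ refl) }
  ... | inj₂ e∈r′ =
    let k≤a , a<b , _ = edges-within (top i (nodes l′)) r′ e∈r′
        _ , _ , b≤k   = edges-within i l (inner⊆edges i l e∈)
    in contradiction (≤-trans b≤k (≤-trans (≤-reflexive (cong (top i) l≡l′)) k≤a)) (<⇒≱ (<-trans (n<1+n a) a<b))
  subʳ : inner (top i (nodes l)) r ⊆ inner (top i (nodes l)) r′
  subʳ {a , b} e∈ with ∈-++⁻ (edges i l′) (sub (∈-++⁺ʳ (edges i l) (inner⊆edges (top i (nodes l)) r e∈)))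
  ... | inj₁ e∈l′ =
    let _ , a<b , b≤k = edges-within i l′ e∈l′
        k≤a , _ = edges-within (top i (nodes l)) r (inner⊆edges _ r e∈)
    in contradiction (≤-trans b≤k (≤-trans (≤-reflexive (cong (top i) (sym l≡l′))) k≤a)) (<⇒≱ (<-trans (n<1+n a) a<b))
  ... | inj₂ e∈r′ = edges⇒inner (top i (nodes l)) r′
    (subst (λ x → (a , b) ∈ edges (top i x) r′) (sym l≡l′) e∈r′) λ { refl →
      <-irrefl (cong (top (top i (nodes l))) (sym r≡r′)) (inner-proper (top i (nodes l)) r e∈ refl) }

-- From maximal non-crossing sets to trees and back

diagonal⁻ : ∀ n {a b} → IsDiagonal (2 + n) (a , b) → suc a < b × b ≤ suc n × (a , b) ≢ (0 , suc n)
diagonal⁻ n {a} {b} (a<b , b<N , ¬side) =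
  ≤∧≢⇒< a<b (λ { refl → ¬side (inj₁ (subst (2 + n ∣_) (sym (∣n-n∣≡0 (suc a))) ((2 + n) ∣0))) }) ,
  s≤s⁻¹ b<N ,
  λ { refl → ¬side (inj₂ ∣-refl) }

∸-∤ : ∀ {m n N} → n < m → m ∸ n < N → ¬ (N ∣ ∣ m - n ∣)
∸-∤ {m} {n} {N} n<m lt p = <⇒≱ lt (∣⇒≤ {{>-nonZero (m<n⇒0<n∸m n<m)}} (subst (N ∣_) (m≤n⇒∣n-m∣≡n∸m (<⇒≤ n<m)) p))

diagonal⁺ : ∀ n {a b} → suc a < b → b ≤ suc n → (a , b) ≢ (0 , suc n) → IsDiagonal (2 + n) (a , b)
diagonal⁺ n {a} {b} a<b b≤ ≢base = <-trans (n<1+n a) a<b , s≤s b≤ , ¬side a a<b ≢base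
  where
  ¬side : ∀ a → suc a < b → (a , b) ≢ (0 , suc n) → ¬ IsSide (2 + n) (a , b)
  ¬side a       lt _     (inj₁ p) = ∸-∤ lt (s≤s (≤-trans (m∸n≤m b (suc a)) b≤))
                                      (subst (2 + n ∣_) (∣-∣-comm (suc a) b) p)
  ¬side zero    _  ≢base (inj₂ p) = ≢base (cong (0 ,_) (≤-antisym b≤ (s≤s⁻¹ (∣⇒≤ p))))
  ¬side (suc a) lt _     (inj₂ p) = ∸-∤ (<-trans (n<1+n a) (<-trans (n<1+n (suc a)) lt)) (s≤s (≤-trans (m∸n≤m b a) b≤)) p

side-¬Crossing : ∀ {i e} → ¬ Crossing (i , suc i) e
side-¬Crossing (inj₁ (i<c , c<1+i , _))     = <⇒≱ i<c (s≤s⁻¹ c<1+i)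
side-¬Crossing (inj₂ (_ , i<d , d<1+i)) = <⇒≱ i<d (s≤s⁻¹ d<1+i)

-- The apex of the triangle on the edge (i , top i (suc m)) is the last neighbour of i before
-- the far end: an edge crossing (top i a , top i (suc m)) would also cross a known edge.
module FromTriangulation (n : ℕ) (S : List Segment)
  (S-diag : ∀ {e} → e ∈ S → IsDiagonal (2 + n) e)
  (S-nc : ∀ {d e} → d ∈ S → e ∈ S → ¬ Crossing d e)
  (S-blocked : ∀ {d} → IsDiagonal (2 + n) d → Blocked S d)
  where

  Free : Segment → Set
  Free d = ∀ {e} → e ∈ S → ¬ Crossing d e

  -- The alternative `a ≡ 0` stands for the side `(i , suc i)`, which joins `i` to a neighbour
  -- without being a diagonal in `S`.
  LastNeighbour : ℕ → ℕ → ℕ → Set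
  LastNeighbour i m a = a ≤ m × (a ≡ 0 ⊎ (i , top i a) ∈ S) ×
    (∀ a′ → a < a′ → a′ ≤ m → ¬ ((i , top i a′) ∈ S))

  lastNeighbour : ∀ i m → ∃ (LastNeighbour i m)
  lastNeighbour i zero = 0 , z≤n , inj₁ refl , λ a′ 0<a′ a′≤0 → contradiction a′≤0 (<⇒≱ 0<a′)
  lastNeighbour i (suc m) with (i , top i (suc m)) ∈? S
  ... | yes ∈S = suc m , ≤-refl , inj₂ ∈S , λ a′ m<a′ a′≤m → contradiction a′≤m (<⇒≱ m<a′)
  ... | no ∉S with lastNeighbour i m
  ...   | a , a≤m , nb , last = a , m≤n⇒m≤1+n a≤m , nb , last′
    where
    last′ : ∀ a′ → a < a′ → a′ ≤ suc m → ¬ ((i , top i a′) ∈ S)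
    last′ a′ a<a′ a′≤ with m≤n⇒m<n∨m≡n a′≤
    ... | inj₁ lt   = last a′ a<a′ (s≤s⁻¹ lt)
    ... | inj₂ refl = ∉S

  neighbour-free : ∀ i a → a ≡ 0 ⊎ (i , top i a) ∈ S → Free (i , top i a)
  neighbour-free i a (inj₂ ∈S)   = S-nc ∈S
  neighbour-free i a (inj₁ refl) {e} _ =
    subst (λ k → ¬ Crossing (i , suc k) e) (sym (+-identityʳ i)) (side-¬Crossing {e = e})

  apex-edge : ∀ i a b → top (top i a) b ≤ suc n → Free (i , top (top i a) b) → Free (i , top i a) →
    (∀ a′ → a < a′ → a′ ≤ a + b → ¬ ((i , top i a′) ∈ S)) →
    b ≡ 0 ⊎ (top i a , top (top i a) b) ∈ S
  apex-edge i a zero    _    _    _    _    = inj₁ refl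
  apex-edge i a (suc b) top≤ free freeˡ last
    with S-blocked (diagonal⁺ n (s≤s (m<m+n (top i a) z<s)) top≤ λ ())
  ... | inj₁ ∈S = inj₂ ∈S
  ... | inj₂ ((c , d) , e∈ , inj₁ (k<c , c<j , j<d)) =
    contradiction (inj₁ (<-trans (i<top i a) k<c , c<j , j<d)) (free e∈)
  ... | inj₂ ((c , d) , e∈ , inj₂ (c<k , k<d , d<j)) with <-cmp c i
  ...   | tri< c<i _ _ = contradiction (inj₂ (c<i , <-trans (i<top i a) k<d , d<j)) (free e∈)
  ...   | tri> _ _ i<c = contradiction (inj₁ (i<c , c<k , k<d)) (freeˡ e∈)
  -- The crossing edge starts at `i` and ends strictly between the apex and the far end: a later
  -- neighbour of `i`.
  ...   | tri≈ _ refl _ = contradiction (subst (λ x → (i , x) ∈ S) d≡ e∈) (last a′ a<a′ a′≤)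
    where
    a′ = d ∸ suc i
    d≡ : d ≡ top i a′
    d≡ = sym (m+[n∸m]≡n (<-trans (i<top i a) k<d))
    a<a′ : a < a′
    a<a′ = +-cancelˡ-< (suc i) a a′ (subst (top i a <_) d≡ k<d)
    a′≤ : a′ ≤ a + suc b
    a′≤ = s≤s⁻¹ (+-cancelˡ-< (suc i) a′ (suc (a + suc b))
      (subst₂ _<_ d≡ (top-top i a (suc b)) d<j))

  edges⊆ : ∀ i t → inner i t ⊆ S → nodes t ≡ 0 ⊎ (i , top i (nodes t)) ∈ S → edges i t ⊆ S
  edges⊆ i (node l r) sub (inj₂ ∈S) (here refl) = ∈S
  edges⊆ i (node l r) sub _         (there e∈)  = sub e∈

  -- The base is only required to be crossed by nothing in `S`, not to belong to it, because sides
  -- of the polygon also occur as bases.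
  TreeAt : ℕ → ℕ → Set
  TreeAt d i = top i d ≤ suc n → Free (i , top i d) → ∃[ t ] nodes t ≡ d × inner i t ⊆ S

  node-at : ∀ i a b → TreeAt a i → TreeAt b (top i a) →
    a ≡ 0 ⊎ (i , top i a) ∈ S → (∀ a′ → a < a′ → a′ ≤ a + b → ¬ ((i , top i a′) ∈ S)) →
    top (top i a) b ≤ suc n → Free (i , top (top i a) b) →
    ∃[ t ] nodes t ≡ suc (a + b) × inner i t ⊆ S
  node-at i a b treeˡ treeʳ nb last top≤ free
    with nbʳ ← apex-edge i a b top≤ free (neighbour-free i a nb) last
    with treeˡ (≤-trans (<⇒≤ (i<top (top i a) b)) top≤) (neighbour-free i a nb)
       | treeʳ top≤ (neighbour-free (top i a) b nbʳ)
  ... | l , refl , subˡ | r , refl , subʳ = node l r , refl , sub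
    where
    sub : edges i l ++ edges (top i (nodes l)) r ⊆ S
    sub e∈ with ∈-++⁻ (edges i l) e∈
    ... | inj₁ e∈l = edges⊆ i l subˡ nb e∈l
    ... | inj₂ e∈r = edges⊆ (top i (nodes l)) r subʳ nbʳ e∈r

  tree : ∀ d i → TreeAt d i
  tree = <-rec _ step
    where
    step : ∀ d → (∀ {k} → k < d → ∀ i → TreeAt k i) → ∀ i → TreeAt d i
    step zero    _   i _ _ = leaf , refl , λ ()
    -- The search is bounded by `m`, so that the base itself, which ends at `top i (suc m)`, is not
    -- taken for the last neighbour.
    step (suc m) rec i top≤ free with lastNeighbour i m
    ... | a , a≤m , nb , last with m ∸ a | m+[n∸m]≡n a≤m
    ...   | b | refl = node-at i a b (rec (s≤s a≤m) i) (rec (s≤s (m≤n+m b a)) (top i a)) nb last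
      (subst (_≤ suc n) (sym (top-top i a b)) top≤)
      (subst (λ x → Free (i , x)) (sym (top-top i a b)) free)

_≋_ : List Segment → List Segment → Set
S ≋ T = S ⊆ T × T ⊆ S

triangulation⇒blocked : ∀ N S → IsTriangulation N S → ∀ {d} → IsDiagonal N d → Blocked S d
triangulation⇒blocked N S ((diag , nc) , maximal) {d} isd with Any.any? (crossing? d) S
... | yes any = let e , e∈ , cr = find any in inj₂ (e , e∈ , cr)
... | no ¬any = inj₁ (maximal (d ∷ S) (isd ∷ diag , nc′) there (here refl))
  where
  free : All (λ e → ¬ Crossing d e) S
  free = All.tabulate λ e∈ cr → ¬any (lose e∈ cr)
  nc′ : All (λ x → All (λ e → ¬ Crossing x e) (d ∷ S)) (d ∷ S)
  nc′ = (crossing-irrefl d ∷ free) ∷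
    All.tabulate λ e∈ → (λ cr → All.lookup free e∈ (swap cr)) ∷ All.lookup nc e∈

-- The tree is built inside `S`. Conversely, by `inner-blocked` a diagonal of `S` outside the tree
-- would cross an edge of the tree, which is again in `S`.
triangulation⇒tree : ∀ n S → IsTriangulation (2 + n) S → ∃[ t ] nodes t ≡ n × S ≋ inner 0 t
triangulation⇒tree n S tri@((diag , nc) , _) = t , refl-nodes , S⊆ , sub
  where
  S-diag : ∀ {e} → e ∈ S → IsDiagonal (2 + n) e
  S-diag = All.lookup diag
  S-nc : ∀ {d e} → d ∈ S → e ∈ S → ¬ Crossing d e
  S-nc d∈ = All.lookup (All.lookup nc d∈)
  open FromTriangulation n S S-diag S-nc (triangulation⇒blocked (2 + n) S tri)
  base-free : Free (0 , top 0 n)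
  base-free e∈ = let _ , b≤ , _ = diagonal⁻ n (S-diag e∈) in outside-¬Crossing z≤n b≤
  result = tree n 0 ≤-refl base-free
  t = proj₁ result
  refl-nodes = proj₁ (proj₂ result)
  sub = proj₂ (proj₂ result)
  S⊆ : S ⊆ inner 0 t
  S⊆ {a , b} e∈ with a<b , b≤ , ≢base ← diagonal⁻ n (S-diag e∈)
    with inner-blocked 0 t z≤n a<b (subst (b ≤_) (cong suc (sym refl-nodes)) b≤)
           (subst (λ k → (a , b) ≢ (0 , suc k)) (sym refl-nodes) ≢base)
  ... | inj₁ ∈t             = ∈t
  ... | inj₂ (e , e∈t , cr) = contradiction cr (S-nc e∈ (sub e∈t))

inner-diagonal : ∀ n t → nodes t ≡ n → ∀ {e} → e ∈ inner 0 t → IsDiagonal (2 + n) e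
inner-diagonal n t refl {a , b} e∈ =
  let _ , a<b , b≤ = edges-within 0 t (inner⊆edges 0 t e∈)
  in diagonal⁺ n a<b b≤ λ { refl → <-irrefl refl (inner-proper 0 t e∈ refl) }

tree⇒triangulation : ∀ n S t → nodes t ≡ n → S ≋ inner 0 t → IsTriangulation (2 + n) S
tree⇒triangulation n S t refl (S⊆ , ⊆S) =
  ( All.tabulate (λ e∈ → inner-diagonal n t refl (S⊆ e∈))
  , All.tabulate λ d∈ → All.tabulate λ e∈ →
      edges-¬Crossing 0 t (inner⊆edges 0 t (S⊆ d∈)) (inner⊆edges 0 t (S⊆ e∈)) )
  , maximal
  where
  maximal : ∀ T → IsNonCrossing (2 + n) T → S ⊆ T → T ⊆ S
  maximal T (diag , nc) S⊆T {a , b} d∈ with a<b , b≤ , ≢base ← diagonal⁻ n (All.lookup diag d∈)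
    with inner-blocked 0 t z≤n a<b b≤ ≢base
  ... | inj₁ ∈t             = ⊆S ∈t
  ... | inj₂ (e , e∈t , cr) = contradiction cr (All.lookup (All.lookup nc d∈) (S⊆T (⊆S e∈t)))

-- Enumerating triangulations

module _ {A B : Set} (R : A → B → Set) where

  -- A relation replaces a function because trees and lists of diagonals correspond only up to `≋`.
  -- Each partner is deleted from `ys`; injectivity ensures that no later element asks for it.
  length-≤ : ∀ {xs : List A} → Unique xs → (ys : List B) →
    (∀ {x} → x ∈ xs → ∃[ y ] y ∈ ys × R x y) →
    (∀ {x x′ y} → x ∈ xs → x′ ∈ xs → R x y → R x′ y → x ≡ x′) →
    length xs ≤ length ys
  length-≤ {[]}     _          ys _  _   = z≤n
  length-≤ {x ∷ xs} (x∉ ∷ xs!) ys to inj with to (here refl)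
  ... | y , y∈ , Rxy with ∈-∃++ y∈
  ...   | ys₁ , ys₂ , refl = ≤-trans (s≤s (length-≤ xs! (ys₁ ++ ys₂) to′ λ p q → inj (there p) (there q)))
          (≤-reflexive (trans (cong suc (length-++ ys₁)) (trans (sym (+-suc (length ys₁) (length ys₂))) (sym (length-++ ys₁)))))
    where
    to′ : ∀ {x′} → x′ ∈ xs → ∃[ y′ ] y′ ∈ ys₁ ++ ys₂ × R x′ y′
    to′ x′∈ with to (there x′∈)
    ... | y′ , y′∈ , Rx′y′ with ∈-++⁻ ys₁ y′∈
    ...   | inj₁ ∈₁         = y′ , ∈-++⁺ˡ ∈₁ , Rx′y′
    ...   | inj₂ (there ∈₂) = y′ , ∈-++⁺ʳ ys₁ ∈₂ , Rx′y′
    ...   | inj₂ (here refl) =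
      contradiction (inj (here refl) (there x′∈) Rxy Rx′y′) (All.lookup x∉ x′∈)

module _ {A : Set} where

  subsets-⊆ : ∀ (xs : List A) {S} → S ∈ subsets xs → S ⊆ xs
  subsets-⊆ []       (here refl) e∈ = e∈
  subsets-⊆ (x ∷ xs) S∈ e∈ with ∈-++⁻ (map (x ∷_) (subsets xs)) S∈
  ... | inj₂ S∈₂ = there (subsets-⊆ xs S∈₂ e∈)
  ... | inj₁ S∈₁ with ∈-map⁻ (x ∷_) S∈₁
  ...   | T , T∈ , refl with e∈
  ...     | here refl = here refl
  ...     | there e∈T = there (subsets-⊆ xs T∈ e∈T)

  filter∈subsets : ∀ {P : Pred A 0ℓ} (P? : Decidable P) xs → filter P? xs ∈ subsets xs
  filter∈subsets P? []       = here refl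
  filter∈subsets P? (x ∷ xs) with P? x
  ... | yes _ = ∈-++⁺ˡ (∈-map⁺ (x ∷_) (filter∈subsets P? xs))
  ... | no  _ = ∈-++⁺ʳ (map (x ∷_) (subsets xs)) (filter∈subsets P? xs)

  subsets-unique : ∀ {xs : List A} → Unique xs → Unique (subsets xs)
  subsets-unique []                  = [] ∷ []
  subsets-unique {x ∷ xs} (x∉ ∷ xs!) =
    Unique.++⁺ (Unique.map⁺ ∷-injectiveʳ (subsets-unique xs!)) (subsets-unique xs!) disjoint
    where
    disjoint : ∀ {S} → ¬ (S ∈ map (x ∷_) (subsets xs) × S ∈ subsets xs)
    disjoint (S∈₁ , S∈₂) with ∈-map⁻ (x ∷_) S∈₁
    ... | T , _ , refl = All.lookup x∉ (subsets-⊆ xs S∈₂ (here refl)) refl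

  -- Members of `subsets xs` keep the order of `xs`, so their elements determine them as lists.
  subsets-extensional : ∀ {xs : List A} → Unique xs → ∀ {S T} → S ∈ subsets xs → T ∈ subsets xs →
    S ⊆ T → T ⊆ S → S ≡ T
  subsets-extensional []                  (here refl) (here refl) _ _ = refl
  subsets-extensional {x ∷ xs} (x∉ ∷ xs!) {S} {T} S∈ T∈ S⊆T T⊆S
    with ∈-++⁻ (map (x ∷_) (subsets xs)) S∈ | ∈-++⁻ (map (x ∷_) (subsets xs)) T∈
  ... | inj₂ S∈₂ | inj₂ T∈₂ = subsets-extensional xs! S∈₂ T∈₂ S⊆T T⊆S
  ... | inj₁ S∈₁ | inj₂ T∈₂ with ∈-map⁻ (x ∷_) S∈₁
  ...   | _ , _ , refl = contradiction refl (All.lookup x∉ (subsets-⊆ xs T∈₂ (S⊆T (here refl))))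
  subsets-extensional {x ∷ xs} (x∉ ∷ xs!) {S} {T} S∈ T∈ S⊆T T⊆S
      | inj₂ S∈₂ | inj₁ T∈₁ with ∈-map⁻ (x ∷_) T∈₁
  ...   | _ , _ , refl = contradiction refl (All.lookup x∉ (subsets-⊆ xs S∈₂ (T⊆S (here refl))))
  subsets-extensional {x ∷ xs} (x∉ ∷ xs!) {S} {T} S∈ T∈ S⊆T T⊆S
      | inj₁ S∈₁ | inj₁ T∈₁ with ∈-map⁻ (x ∷_) S∈₁ | ∈-map⁻ (x ∷_) T∈₁
  ...   | S′ , S′∈ , refl | T′ , T′∈ , refl =
    cong (x ∷_) (subsets-extensional xs! S′∈ T′∈ (drop-x S′∈ S⊆T) (drop-x T′∈ T⊆S))
    where
    drop-x : ∀ {U V} → U ∈ subsets xs → x ∷ U ⊆ x ∷ V → U ⊆ V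
    drop-x U∈ sub e∈ with sub (there e∈)
    ... | here refl = contradiction refl (All.lookup x∉ (subsets-⊆ xs U∈ e∈))
    ... | there e∈V = e∈V

diagonals-unique : ∀ N → Unique (diagonals N)
diagonals-unique N =
  Unique.filter⁺ (isDiagonal? N) (Unique.cartesianProduct⁺ (Unique.upTo⁺ N) (Unique.upTo⁺ N))

concat-∑ : {A : Set} → (ℕ → ℕ → List A) → ℕ → List A
concat-∑ h zero    = h 0 0
concat-∑ h (suc n) = h 0 (suc n) ++ concat-∑ (λ a b → h (suc a) b) n

module _ {A : Set} where

  length-concat-∑ : ∀ (h : ℕ → ℕ → List A) n → length (concat-∑ h n) ≡ ∑ (λ a b → length (h a b)) n
  length-concat-∑ h zero    = refl
  length-concat-∑ h (suc n) = trans (length-++ (h 0 (suc n)))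
    (cong (length (h 0 (suc n)) +_) (length-concat-∑ (λ a → h (suc a)) n))

  concat-∑-cong : ∀ {h k : ℕ → ℕ → List A} n → (∀ a b → a + b ≡ n → h a b ≡ k a b) →
    concat-∑ h n ≡ concat-∑ k n
  concat-∑-cong zero    eq = eq 0 0 refl
  concat-∑-cong (suc n) eq =
    cong₂ _++_ (eq 0 (suc n) refl) (concat-∑-cong n λ a b p → eq (suc a) b (cong suc p))

  ∈-concat-∑⁺ : ∀ (h : ℕ → ℕ → List A) a b {x} → x ∈ h a b → x ∈ concat-∑ h (a + b)
  ∈-concat-∑⁺ h zero    zero    x∈ = x∈
  ∈-concat-∑⁺ h zero    (suc b) x∈ = ∈-++⁺ˡ x∈
  ∈-concat-∑⁺ h (suc a) b       x∈ = ∈-++⁺ʳ (h 0 _) (∈-concat-∑⁺ (λ a → h (suc a)) a b x∈)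

  ∈-concat-∑⁻ : ∀ (h : ℕ → ℕ → List A) n {x} → x ∈ concat-∑ h n → ∃[ a ] ∃[ b ] a + b ≡ n × x ∈ h a b
  ∈-concat-∑⁻ h zero    x∈ = 0 , 0 , refl , x∈
  ∈-concat-∑⁻ h (suc n) x∈ with ∈-++⁻ (h 0 (suc n)) x∈
  ... | inj₁ x∈₀ = 0 , suc n , refl , x∈₀
  ... | inj₂ x∈₁ = let a , b , eq , x∈′ = ∈-concat-∑⁻ (λ a → h (suc a)) n x∈₁
                   in suc a , b , cong suc eq , x∈′

  concat-∑-unique : ∀ (h : ℕ → ℕ → List A) n → (∀ a b → a + b ≡ n → Unique (h a b)) →
    (∀ {a b a′ b′ x} → x ∈ h a b → x ∈ h a′ b′ → a ≡ a′) → Unique (concat-∑ h n)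
  concat-∑-unique h zero    h! _  = h! 0 0 refl
  concat-∑-unique h (suc n) h! eq = Unique.++⁺ (h! 0 (suc n) refl)
    (concat-∑-unique (λ a → h (suc a)) n (λ a b p → h! (suc a) b (cong suc p)) (λ p q → suc-injective (eq p q)))
    λ (x∈₀ , x∈₁) → let _ , _ , _ , x∈ = ∈-concat-∑⁻ (λ a → h (suc a)) n x∈₁ in 0≢1+n (eq x∈₀ x∈)

module Enumeration {P : Segment → Set} (P? : Decidable P) where

  -- The first argument bounds the depth of the recursion; any bound ≥ d gives the same list.
  trees roots : ℕ → ℕ → ℕ → List Tree

  trees f       i zero    = leaf ∷ []
  trees zero    i (suc n) = []
  trees (suc f) i (suc n) = if does (P? (i , top i (suc n))) then roots f i n else []

  roots f i n = concat-∑ (λ a b → cartesianProductWith node (trees f i a) (trees f (top i a) b)) n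

  trees-bound : ∀ f f′ i d → d ≤ f → d ≤ f′ → trees f i d ≡ trees f′ i d
  trees-bound f       f′       i zero    _         _          = refl
  trees-bound (suc f) (suc f′) i (suc n) (s≤s n≤f) (s≤s n≤f′) =
    cong (if does (P? (i , top i (suc n))) then_else []) (concat-∑-cong n λ { a b refl →
      cong₂ (cartesianProductWith node)
        (trees-bound f f′ i a (m+n≤o⇒m≤o a n≤f) (m+n≤o⇒m≤o a n≤f′))
        (trees-bound f f′ (top i a) b (m+n≤o⇒n≤o a n≤f) (m+n≤o⇒n≤o a n≤f′)) })

  count root-count : ℕ → ℕ → ℕ
  count i d      = length (trees d i d)
  root-count i n = length (roots n i n)

  count-zero : ∀ i → count i 0 ≡ 1
  count-zero i = refl

  count-forbidden : ∀ i n → ¬ P (i , top i (suc n)) → count i (suc n) ≡ 0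
  count-forbidden i n ¬p with P? (i , top i (suc n))
  ... | yes p = contradiction p ¬p
  ... | no  _ = refl

  count-allowed : ∀ i n → P (i , top i (suc n)) → count i (suc n) ≡ root-count i n
  count-allowed i n p with P? (i , top i (suc n))
  ... | yes _ = refl
  ... | no ¬p = contradiction p ¬p

  length-cartesianProductWith : ∀ {A B C : Set} (g : A → B → C) xs ys →
    length (cartesianProductWith g xs ys) ≡ length xs * length ys
  length-cartesianProductWith g []       ys = refl
  length-cartesianProductWith g (x ∷ xs) ys = trans (length-++ (map (g x) ys))
    (cong₂ _+_ (length-map (g x) ys) (length-cartesianProductWith g xs ys))

  root-count-apex : ∀ i n → root-count i n ≡ ∑ (λ a b → count i a * count (top i a) b) n
  root-count-apex i n = trans (length-concat-∑ _ n) (∑-cong n λ { a b refl →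
    trans (length-cartesianProductWith node (trees n i a) (trees n (top i a) b))
      (cong₂ (λ x y → length x * length y)
        (trees-bound n a i a (m≤m+n a b) ≤-refl)
        (trees-bound n b (top i a) b (m≤n+m b a) ≤-refl)) })

  ∈-trees⁻ : ∀ f i d {t} → t ∈ trees f i d → nodes t ≡ d × All P (edges i t)
  ∈-roots⁻ : ∀ f i n {t} → t ∈ roots f i n → nodes t ≡ suc n × All P (inner i t)

  ∈-trees⁻ f       i zero    (here refl) = refl , []
  ∈-trees⁻ (suc f) i (suc n) t∈ with P? (i , top i (suc n))
  ... | no  _ = contradiction t∈ λ ()
  ... | yes p with ∈-roots⁻ f i n t∈
  ∈-trees⁻ (suc f) i (suc n) {node l r} t∈ | yes p | refl , ps = refl , p ∷ ps

  ∈-roots⁻ f i n t∈ with ∈-concat-∑⁻ _ n t∈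
  ... | a , b , refl , t∈ab with ∈-cartesianProductWith⁻ node (trees f i a) (trees f (top i a) b) t∈ab
  ...   | l , r , l∈ , r∈ , refl with ∈-trees⁻ f i a l∈ | ∈-trees⁻ f (top i a) b r∈
  ...     | refl , pl | refl , pr = refl , All.++⁺ pl pr

  ∈-trees⁺ : ∀ f i t → nodes t ≤ f → All P (edges i t) → t ∈ trees f i (nodes t)
  ∈-roots⁺ : ∀ f i l r → nodes l + nodes r ≤ f → All P (inner i (node l r)) →
    node l r ∈ roots f i (nodes l + nodes r)

  ∈-trees⁺ f       i leaf       _         _        = here refl
  ∈-trees⁺ (suc f) i (node l r) (s≤s n≤f) (p ∷ ps) with P? (i , top i (suc (nodes l + nodes r)))
  ... | yes _ = ∈-roots⁺ f i l r n≤f ps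
  ... | no ¬p = contradiction p ¬p

  ∈-roots⁺ f i l r n≤f ps = ∈-concat-∑⁺ _ (nodes l) (nodes r)
    (∈-cartesianProductWith⁺ node
      (∈-trees⁺ f i l (m+n≤o⇒m≤o _ n≤f) (All.++⁻ˡ (edges i l) ps))
      (∈-trees⁺ f (top i (nodes l)) r (m+n≤o⇒n≤o (nodes l) n≤f) (All.++⁻ʳ (edges i l) ps)))

  node-injective : ∀ {w x y z} → node w y ≡ node x z → w ≡ x × y ≡ z
  node-injective refl = refl , refl

  trees-unique : ∀ f i d → Unique (trees f i d)
  roots-unique : ∀ f i n → Unique (roots f i n)

  trees-unique f       i zero    = [] ∷ []
  trees-unique zero    i (suc n) = []
  trees-unique (suc f) i (suc n) with P? (i , top i (suc n))
  ... | yes _ = roots-unique f i n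
  ... | no  _ = []

  roots-unique f i n = concat-∑-unique _ n
    (λ a b _ → Unique.cartesianProductWith⁺ node node-injective (trees-unique f i a) (trees-unique f (top i a) b))
    (λ {a} {b} {a′} {b′} → same-apex {a} {b} {a′} {b′})
    where
    same-apex : ∀ {a b a′ b′ t} →
      t ∈ cartesianProductWith node (trees f i a) (trees f (top i a) b) →
      t ∈ cartesianProductWith node (trees f i a′) (trees f (top i a′) b′) → a ≡ a′
    same-apex {a} {b} {a′} {b′} t∈ t∈′
      with ∈-cartesianProductWith⁻ node (trees f i a) (trees f (top i a) b) t∈
         | ∈-cartesianProductWith⁻ node (trees f i a′) (trees f (top i a′) b′) t∈′
    ... | l , r , l∈ , _ , refl | _ , _ , l∈′ , _ , refl =
      trans (sym (proj₁ (∈-trees⁻ f i a l∈))) (proj₁ (∈-trees⁻ f i a′ l∈′))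

  -- Injections along `≋` in both directions. The roots are not tested against `P`, since the base
  -- `(0 , 2 + n)` of the whole polygon is a side.
  f≡root-count : ∀ x y n →
    (∀ {d} → IsDiagonal (3 + n) d → P d ⇔ (¬ Parallel (3 + n) d (x , y))) →
    f x y (3 + n) ≡ root-count 0 n
  f≡root-count x y n P⇔ = ≤-antisym
    (length-≤ (λ S t → S ≋ inner 0 t) Good! (roots n 0 n)
      good⇒tree λ S∈ T∈ (S⊆ , ⊆S) (T⊆ , ⊆T) →
        subsets-extensional (diagonals-unique N) (subset S∈) (subset T∈) (λ e∈ → ⊆T (S⊆ e∈)) (λ e∈ → ⊆S (T⊆ e∈)))
    (length-≤ (λ t S → S ≋ inner 0 t) (roots-unique n 0 n) (filter Good? (subsets (diagonals N)))
      tree⇒good λ {t} {t′} t∈ t′∈ (S⊆ , ⊆S) (S⊆′ , ⊆S′) →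
        inner-injective 0 t t′ (trans (size t∈) (sym (size t′∈))) (λ e∈ → S⊆′ (⊆S e∈)))
    where
    N = 3 + n
    Good : List Segment → Set
    Good S = IsTriangulation N S × NoParallel N (x , y) S
    Good? : Decidable Good
    Good? S = isTriangulation? N S ×-dec noParallel? N (x , y) S
    Good! = Unique.filter⁺ Good? (subsets-unique (diagonals-unique N))
    subset : ∀ {S} → S ∈ filter Good? (subsets (diagonals N)) → S ∈ subsets (diagonals N)
    subset S∈ = proj₁ (∈-filter⁻ Good? S∈)
    size : ∀ {t} → t ∈ roots n 0 n → nodes t ≡ suc n
    size t∈ = proj₁ (∈-roots⁻ n 0 n t∈)

    good⇒tree : ∀ {S} → S ∈ filter Good? (subsets (diagonals N)) → ∃[ t ] t ∈ roots n 0 n × S ≋ inner 0 t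
    good⇒tree {S} S∈ with ∈-filter⁻ Good? {xs = subsets (diagonals N)} S∈
    ... | _ , tri@((diag , _) , _) , np with triangulation⇒tree (suc n) S tri
    ...   | t@(node l r) , refl , (S⊆ , ⊆S) = t , ∈-roots⁺ n 0 l r ≤-refl Ps , (S⊆ , ⊆S)
      where
      Ps : All P (inner 0 t)
      Ps = All.tabulate λ e∈ → Equivalence.from (P⇔ (All.lookup diag (⊆S e∈))) (All.lookup np (⊆S e∈))

    tree⇒good : ∀ {t} → t ∈ roots n 0 n → ∃[ S ] S ∈ filter Good? (subsets (diagonals N)) × S ≋ inner 0 t
    tree⇒good {t} t∈ = S , ∈-filter⁺ Good? (filter∈subsets (_∈? inner 0 t) (diagonals N)) (tri , np) , S≋
      where
      S = filter (_∈? inner 0 t) (diagonals N)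
      isDiag : ∀ {e} → e ∈ inner 0 t → IsDiagonal N e
      isDiag = inner-diagonal (suc n) t (size t∈)
      S≋ : S ≋ inner 0 t
      S≋ = (λ e∈ → proj₂ (∈-filter⁻ (_∈? inner 0 t) {xs = diagonals N} e∈))
         , (λ e∈ → ∈-filter⁺ (_∈? inner 0 t) (∈-diagonals N (isDiag e∈)) e∈)
      tri = tree⇒triangulation (suc n) S t (size t∈) S≋
      np : NoParallel N (x , y) S
      np = All.tabulate λ e∈ → let e∈t = proj₁ S≋ e∈ in
        Equivalence.to (P⇔ (isDiag e∈t)) (All.lookup (proj₂ (∈-roots⁻ n 0 n t∈)) e∈t)

module _ {P Q : Segment → Set} (P? : Decidable P) (Q? : Decidable Q) where

  open Enumeration

  trees-cong : ∀ f i d → (∀ j n → i ≤ j → P (j , top j (suc n)) ⇔ Q (j , top j (suc n))) → trees P? f i d ≡ trees Q? f i d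
  trees-cong f       i zero    _   = refl
  trees-cong zero    i (suc n) _   = refl
  trees-cong (suc f) i (suc n) P⇔Q = cong₂ (λ x y → if x then y else [])
    (does-⇔ (P⇔Q i n ≤-refl) (P? _) (Q? _))
    (concat-∑-cong n λ a b _ → cong₂ (cartesianProductWith node)
      (trees-cong f i a P⇔Q)
      (trees-cong f (top i a) b λ j m k≤j → P⇔Q j m (≤-trans (<⇒≤ (i<top i a)) k≤j)))

-- Parallel diagonals as rungs

open Enumeration

∣-<2*⇒≡ : ∀ {N m} → N ∣ m → m < 2 * N → m ≡ 0 ⊎ m ≡ N
∣-<2*⇒≡     (divides zero          eq) _  = inj₁ eq
∣-<2*⇒≡ {N} (divides (suc zero)    eq) _  = inj₂ (trans eq (+-identityʳ N))
∣-<2*⇒≡ {N} (divides (suc (suc q)) refl) lt =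
  contradiction lt (≤⇒≯ (*-monoˡ-≤ N (s≤s (s≤s (z≤n {q})))))

module _ {n a b : ℕ} (d : IsDiagonal (2 + n) (a , b)) where

  private
    N = 2 + n

    a+b≥2 : 2 ≤ a + b
    a+b≥2 = ≤-trans (s≤s (s≤s z≤n)) (≤-trans (proj₁ (diagonal⁻ n d)) (m≤n+m b a))

    a+b<2N : a + b < 2 * N
    a+b<2N = <-≤-trans (+-mono-< (<-trans (proj₁ d) (proj₁ (proj₂ d))) (proj₁ (proj₂ d)))
      (≤-reflexive (cong (N +_) (sym (+-identityʳ N))))

  -- A diagonal has 2 ≤ a + b < 2N. With y ≤ 2 the difference a + b - y is thus a nonnegative
  -- multiple of N below 2N.
  parallel⁻ : ∀ y → y ≤ 2 → Parallel N (a , b) (0 , y) → a + b ≡ y ⊎ a + b ≡ N + y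
  parallel⁻ y y≤2 p with ∣-<2*⇒≡ (subst (N ∣_) (m≤n⇒∣n-m∣≡n∸m y≤a+b) p) (≤-<-trans (m∸n≤m (a + b) y) a+b<2N)
    where
    y≤a+b : y ≤ a + b
    y≤a+b = ≤-trans y≤2 a+b≥2
  ... | inj₁ eq = inj₁ (≤-antisym (m∸n≡0⇒m≤n eq) (≤-trans y≤2 a+b≥2))
  ... | inj₂ eq = inj₂ (trans (sym (m∸n+n≡m (≤-trans y≤2 a+b≥2))) (cong (_+ y) eq))

  parallel⁺ : ∀ y → a + b ≡ y ⊎ a + b ≡ N + y → Parallel N (a , b) (0 , y)
  parallel⁺ y (inj₁ eq) = subst (N ∣_) (sym (m≡n⇒∣m-n∣≡0 eq)) (N ∣0)
  parallel⁺ y (inj₂ eq) = subst (N ∣_) (sym (trans (cong ∣_- y ∣ (trans eq (+-comm N y))) (trans (∣-∣-comm (y + N) y) (∣m-m+n∣≡n y N)))) ∣-refl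

  parallel01⇔ : (a + b ≢ suc N) ⇔ (¬ Parallel N (a , b) (0 , 1))
  parallel01⇔ = mk⇔
    (λ ≢s p → [ (λ eq → <⇒≢ a+b≥2 (sym eq)) , (λ eq → ≢s (trans eq (+-comm N 1))) ]′ (parallel⁻ 1 (s≤s z≤n) p))
    (λ ¬p eq → ¬p (parallel⁺ 1 (inj₂ (trans eq (+-comm 1 N)))))

  -- In contrast to the direction 01, the smaller sum is attained, by the diagonal `(0 , 2)` and no
  -- other.
  parallel02⇔ : (a + b ≢ 2 × a + b ≢ 2 + N) ⇔ (¬ Parallel N (a , b) (0 , 2))
  parallel02⇔ = mk⇔
    (λ (≢2 , ≢s) p → [ ≢2 , (λ eq → ≢s (trans eq (+-comm N 2))) ]′ (parallel⁻ 2 ≤-refl p))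
    (λ ¬p → (λ eq → ¬p (parallel⁺ 2 (inj₁ eq))) , λ eq → ¬p (parallel⁺ 2 (inj₂ (trans eq (+-comm 2 N)))))

NotRung : ℕ → Segment → Set
NotRung s (a , b) = a + b ≢ s

notRung? : ∀ s → Decidable (NotRung s)
notRung? s (a , b) = ¬? (a + b ≟ s)

module RungCounts (s : ℕ) = Rungs s (count (notRung? s)) (root-count (notRung? s))
  (count-zero (notRung? s))
  (λ i n eq → count-forbidden (notRung? s) i n λ ≢ → ≢ eq)
  (λ i n → count-allowed (notRung? s) i n)
  (root-count-apex (notRung? s))

f01-count : ∀ n → f 0 1 (3 + n) ≡ count (notRung? (4 + n)) 0 (suc n)
f01-count n = trans (f≡root-count (notRung? (4 + n)) 0 1 n λ d → parallel01⇔ d)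
  (sym (count-allowed (notRung? (4 + n)) 0 n (<⇒≢ (<-trans (n<1+n _) (n<1+n _)))))

f01-even : ∀ k → f 0 1 (double (2 + k)) ≡ 2 * catalan (suc (double k))
f01-even k = begin
  f 0 1 (double (2 + k))             ≡⟨ f01-count (suc (double k)) ⟩
  count (notRung? s) 0 d             ≡⟨ +-identityʳ _ ⟨
  count (notRung? s) 0 d + c₁ d      ≡⟨ A-value-2 0 d refl (balance₁ k) ⟩
  2 * catalan (suc (double k))       ∎
  where
  s = suc (double (2 + k))
  d = double (suc k)
  open RungCounts s
  open Values b₁ c₁ refl (balance₁-rung (2 + k))

f01-odd : ∀ k → f 0 1 (suc (double (suc k))) + catalan (suc (double k)) ≡ b₂ (suc (double k))
f01-odd k = trans (cong (_+ catalan (suc (double k))) (f01-count (double k)))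
  (A-value-2 0 (suc (double k)) refl (balance₂ k))
  where
  open RungCounts (double (2 + k))
  open Values b₂ catalan refl (balance₂-rung (2 + k))

-- The direction 02 and its exceptional edge

NotCappedRung : ℕ → Segment → Set
NotCappedRung s (a , b) = a + b ≢ 2 × a + b ≢ s

notCappedRung? : ∀ s → Decidable (NotCappedRung s)
notCappedRung? s (a , b) = ¬? (a + b ≟ 2) ×-dec ¬? (a + b ≟ s)

module Cap (s : ℕ) where

  A A′ : ℕ → ℕ → ℕ
  A  = count (notRung? s)
  A′ = count (notCappedRung? s)

  -- An edge of endpoint sum 2 must start at vertex 0, outside this polygon.
  A′≡A : ∀ i d → A′ (suc i) d ≡ A (suc i) d
  A′≡A i d = cong length (trees-cong (notCappedRung? s) (notRung? s) d (suc i) d λ where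
    (suc j) n _ → mk⇔ proj₂ λ ≢s → (λ eq → 1+n≢0 (m+n≡0⇒n≡0 j (trans (sym (cong pred (+-suc j _))) (cong (λ m → m ∸ 2) eq)))) , ≢s)

  -- Contracting the triangle 012 turns the triangulations of 0, …, n + 2 with the edge (0 , 2) into
  -- those of 1, …, n + 2; rungs are preserved, because no edge at 0 or 1 is one.
  cap-split : ∀ n → 3 + n < s → A′ 0 (suc n) + A 1 n ≡ A 0 (suc n)
  cap-split = <-rec _ step
    where
    Split : ℕ → Set
    Split n = 3 + n < s → A′ 0 (suc n) + A 1 n ≡ A 0 (suc n)
    step : ∀ n → (∀ {k} → k < n → Split k) → Split n
    -- The base of the triangle 0, 1, 2 is the exceptional edge itself, so `A′ 0 1` is 0.
    step zero    _  lt = begin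
      A′ 0 1 + 1   ≡⟨ cong (_+ 1) (count-forbidden (notCappedRung? s) 0 0 λ (≢2 , _) → ≢2 refl) ⟩
      1            ≡⟨ count-allowed (notRung? s) 0 0 (<⇒≢ (<-trans (n<1+n 2) lt)) ⟨
      A 0 1        ∎
    step (suc m) ih lt = begin
      A′ 0 (2 + m) + A 1 (suc m)
        ≡⟨ cong₂ _+_ (trans (count-allowed (notCappedRung? s) 0 (suc m) ((λ ()) , <⇒≢ (<-trans (n<1+n _) lt)))
                            (root-count-apex (notCappedRung? s) 0 (suc m)))
                     (trans (count-allowed (notRung? s) 1 m (<⇒≢ lt)) (root-count-apex (notRung? s) 1 m)) ⟩
      -- The term set apart has its apex at vertex 1. The edge `(0 , 2)` would then cross the one
      -- from 1 to the far end, so this term is common to both sides; for every other apex the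
      -- hypothesis applies to the left factor.
      1 * A′ 1 (suc m) + ∑ (λ a b → A′ 0 (suc a) * A′ (2 + a) b) m + ∑ (λ a b → A 1 a * A (2 + a) b) m
        ≡⟨ cong₂ (λ x y → 1 * x + y + ∑ (λ a b → A 1 a * A (2 + a) b) m)
             (A′≡A 0 (suc m)) (∑-cong m λ a b _ → cong (A′ 0 (suc a) *_) (A′≡A (suc a) b)) ⟩
      1 * A 1 (suc m) + ∑ (λ a b → A′ 0 (suc a) * A (2 + a) b) m + ∑ (λ a b → A 1 a * A (2 + a) b) m
        ≡⟨ +-assoc (1 * A 1 (suc m)) _ _ ⟩
      1 * A 1 (suc m) + (∑ (λ a b → A′ 0 (suc a) * A (2 + a) b) m + ∑ (λ a b → A 1 a * A (2 + a) b) m)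
        ≡⟨ cong (1 * A 1 (suc m) +_) (∑-+ (λ a b → A′ 0 (suc a) * A (2 + a) b) (λ a b → A 1 a * A (2 + a) b) m) ⟨
      1 * A 1 (suc m) + ∑ (λ a b → A′ 0 (suc a) * A (2 + a) b + A 1 a * A (2 + a) b) m
        ≡⟨ cong (1 * A 1 (suc m) +_) (∑-cong m λ { a b refl →
             trans (sym (*-distribʳ-+ (A (2 + a) b) (A′ 0 (suc a)) (A 1 a)))
                   (cong (_* A (2 + a) b) (ih (s≤s (m≤m+n a b)) (≤-<-trans (s≤s (s≤s (s≤s (m≤n⇒m≤1+n (m≤m+n a b))))) lt))) }) ⟩
      1 * A 1 (suc m) + ∑ (λ a b → A 0 (suc a) * A (2 + a) b) m
        ≡⟨ root-count-apex (notRung? s) 0 (suc m) ⟨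
      root-count (notRung? s) 0 (suc m)
        ≡⟨ count-allowed (notRung? s) 0 (suc m) (<⇒≢ (<-trans (n<1+n _) lt)) ⟨
      A 0 (2 + m) ∎

module CapCount (k : ℕ) where

  s : ℕ
  s = double (3 + k)

  open Cap s
  open RungCounts s
  open Values b₂ catalan refl (balance₂-rung (3 + k))

  -- `K 3` lacks the term of width 1. The triangulations through 02, which `F` leaves out, number
  -- `b₂ e` minus `catalan e` by `A-value-2`, and subtracting them restores exactly this term. Full
  -- convolutions with `O` remain, to which `cap-equation` applies.
  cap-count : ∀ F → F + A 1 (suc (double k)) ≡ A 0 (double (suc k)) →
    F + b₂ (suc (double (suc k))) ≡ O (suc k) + (E (suc k) + E (suc k))
  cap-count F F-def = +-cancelʳ-≡ ((O ⊛ b₂-odds) k) _ _ (begin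
    F + b₂ (suc (double (suc k))) + (O ⊛ b₂-odds) k
      ≡⟨ lem₁ F (b₂ (suc (double (suc k)))) ((O ⊛ b₂-odds) k) ⟩
    F + (O ⊛ b₂-odds) k + b₂ (suc (double (suc k)))
      ≡⟨ cong₂ _+_ cut (b₂-odd (suc k)) ⟩
    E (suc k) + (O ⊛ O) k + (E ⊛ E ⊕ E ⊛ E) (suc k)
      ≡⟨ cong (λ x → E (suc k) + x + (E ⊛ E ⊕ E ⊛ E) (suc k)) (X⊛-suc (O ⊛ O) k) ⟨
    (E ⊕ X ⊛ (O ⊛ O) ⊕ (E ⊛ E ⊕ E ⊛ E)) (suc k)
      ≡⟨ cap-equation (suc k) ⟩
    O (suc k) + (E (suc k) + E (suc k)) + (X ⊛ (O ⊛ (E ⊛ E ⊕ E ⊛ E))) (suc k)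
      ≡⟨ cong (O (suc k) + (E (suc k) + E (suc k)) +_)
           (trans (X⊛-suc (O ⊛ (E ⊛ E ⊕ E ⊛ E)) k) (⊛-congˡ O (λ m → sym (b₂-odd m)) k)) ⟩
    O (suc k) + (E (suc k) + E (suc k)) + (O ⊛ b₂-odds) k ∎)
    where
    b₂-odds : Series
    b₂-odds m = b₂ (suc (double m))
    d = double (suc k)
    e = suc (double k)
    lem₁ : ∀ x y z → x + y + z ≡ x + z + y
    lem₁ = solve-∀
    lem₂ : ∀ f x y → f + (x + y) ≡ f + y + x
    lem₂ = solve-∀
    lem₃ : ∀ f a c x → f + (a + c) + x ≡ f + a + x + c
    lem₃ = solve-∀
    cut : F + (O ⊛ b₂-odds) k ≡ E (suc k) + (O ⊛ O) k
    cut = begin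
      F + (O ⊛ b₂-odds) k              ≡⟨ cong (F +_) (K-3-even b₂ k) ⟨
      F + (K 3 b₂ d + b₂ e)            ≡⟨ lem₂ F (K 3 b₂ d) (b₂ e) ⟩
      F + b₂ e + K 3 b₂ d              ≡⟨ cong (λ x → F + x + K 3 b₂ d) (A-value-2 1 e refl (balance₂ k)) ⟨
      F + (A 1 e + catalan e) + K 3 b₂ d ≡⟨ lem₃ F (A 1 e) (catalan e) (K 3 b₂ d) ⟩
      F + A 1 e + K 3 b₂ d + catalan e ≡⟨ cong (λ x → x + K 3 b₂ d + catalan e) F-def ⟩
      A 0 d + K 3 b₂ d + catalan e     ≡⟨ cong (_+ catalan e) (A-value 0 3 d refl) ⟩
      E (suc k) + K 3 catalan d + catalan e ≡⟨ +-assoc (E (suc k)) (K 3 catalan d) (catalan e) ⟩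
      E (suc k) + (K 3 catalan d + catalan e) ≡⟨ cong (E (suc k) +_) (K-3-even catalan k) ⟩
      E (suc k) + (O ⊛ O) k            ∎

f02-even : ∀ k → f 0 2 (double (2 + k)) + b₂ (suc (double (suc k))) ≡
  catalan (suc (double (suc k))) + 2 * catalan (double (suc k))
f02-even k = begin
  f 0 2 (double (2 + k)) + b₂ (suc (double (suc k)))
    ≡⟨ cong (_+ b₂ (suc (double (suc k)))) f≡A′ ⟩
  A′ 0 (double (suc k)) + b₂ (suc (double (suc k)))
    ≡⟨ cap-count (A′ 0 (double (suc k))) (cap-split n (<-trans (n<1+n _) (n<1+n _))) ⟩
  O (suc k) + (E (suc k) + E (suc k))
    ≡⟨ cong (λ x → O (suc k) + (E (suc k) + x)) (+-identityʳ (E (suc k))) ⟨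
  O (suc k) + 2 * E (suc k) ∎
  where
  open CapCount k
  open Cap s
  n = suc (double k)
  f≡A′ : f 0 2 (3 + n) ≡ A′ 0 (suc n)
  f≡A′ = trans (f≡root-count (notCappedRung? s) 0 2 n λ d → parallel02⇔ d)
    (sym (count-allowed (notCappedRung? s) 0 n
      ((λ ()) , <⇒≢ (<-trans (n<1+n _) (<-trans (n<1+n _) (n<1+n _))))))

-- The formulas with subtraction, over the integers

open import Data.Integer using (+_; _-_)
import Data.Integer as ℤ
import Data.Integer.Properties as ℤ

+-difference : ∀ {a b c} → a + b ≡ c → + a ≡ + c - + b
+-difference {a} {b} refl = sym (trans (ℤ.+-assoc (+ a) (+ b) (ℤ.- (+ b)))
  (trans (cong (λ x → + a ℤ.+ x) (ℤ.+-inverseʳ (+ b))) (ℤ.+-identityʳ (+ a))))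

theorem2 :
    (∀ (n : ℕ) → 2 ≤ n →
      f 0 1 (2 * n) ≡ 2 * catalan (2 * n ∸ 3))
    × (∀ (n : ℕ) → 2 ≤ n →
      + f 0 2 (2 * n)
        ≡ + (catalan (2 * n ∸ 1) + 2 * catalan (2 * n ∸ 2))
          - + (2 ^ (2 * n ∸ 1) * catalan (n ∸ 1)))
    × (∀ (n : ℕ) → 1 ≤ n →
      + f 0 1 (2 * n + 1)
        ≡ + (2 ^ (2 * n ∸ 1) * catalan (n ∸ 1)) - + catalan (2 * n ∸ 1))
theorem2 = part₁ , part₂ , part₃
  where
  b₂-value : ∀ k → b₂ (suc (double k)) ≡ 2 ^ suc (double k) * catalan k
  b₂-value k = cong (λ m → 2 ^ suc (double k) * catalan m) (⌊1+double/2⌋ k)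

  part₁ : ∀ n → 2 ≤ n → f 0 1 (2 * n) ≡ 2 * catalan (2 * n ∸ 3)
  part₁ (suc (suc k)) (s≤s (s≤s _)) =
    subst (λ m → f 0 1 m ≡ 2 * catalan (m ∸ 3)) (double≡2* (2 + k)) (f01-even k)

  part₂ : ∀ n → 2 ≤ n → + f 0 2 (2 * n) ≡
    + (catalan (2 * n ∸ 1) + 2 * catalan (2 * n ∸ 2)) - + (2 ^ (2 * n ∸ 1) * catalan (n ∸ 1))
  part₂ (suc (suc k)) (s≤s (s≤s _)) = subst
    (λ m → + f 0 2 m ≡ + (catalan (m ∸ 1) + 2 * catalan (m ∸ 2)) - + (2 ^ (m ∸ 1) * catalan (suc k)))
    (double≡2* (2 + k))
    (+-difference (trans (cong (λ x → f 0 2 (double (2 + k)) + x) (sym (b₂-value (suc k)))) (f02-even k)))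

  part₃ : ∀ n → 1 ≤ n → + f 0 1 (2 * n + 1) ≡
    + (2 ^ (2 * n ∸ 1) * catalan (n ∸ 1)) - + catalan (2 * n ∸ 1)
  part₃ (suc k) _ = subst
    (λ m → + f 0 1 (m + 1) ≡ + (2 ^ (m ∸ 1) * catalan k) - + catalan (m ∸ 1))
    (double≡2* (suc k))
    (subst (λ N → + f 0 1 N ≡ + (2 ^ suc (double k) * catalan k) - + catalan (suc (double k)))
      (+-comm 1 (double (suc k)))
      (+-difference (trans (f01-odd k) (b₂-value k))))
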